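{- Let $b$ be a graph over $(X,m)$ with $m(X)<\infty$ and let $p\in(1,\infty)$. Suppose there is a non-constant weak solution $f\in D_p$ for $\lambda^{(1)}_p$. Then $$\frac{2^{p-1}}{p^{p}}\,\bigl(h^{(1)}_{p}\bigr)^{p}\leq \lambda^{(1)}_{p}.$$
   Context: Setting: $X$ is a nonempty countable (finite or infinite) set and $C(X)$ is the space of real-valued functions on $X$. A graph $b$ over $(X,m)$ consists of a symmetric function $b:X\times X\to[0,\infty)$ with $b(x,x)=0$ and $\sum_{y\in X}b(x,y)<\infty$ for all $x\in X$, and a function $m:X\to(0,\infty)$, extended to a measure on subsets by $m(W)=\sum_{x\in W}m(x)$. No connectedness or boundedness assumption is made. $\ell^p(X,m)$ is the space of $f\in C(X)$ with $\|f\|_{m,p}=\bigl(\sum_{x\in X}|f(x)|^p m(x)\bigr)^{1/p}<\infty$. Energy: $\mathcal{E}_p(f)=\frac12\sum_{x,y\in X}b(x,y)|f(x)-f(y)|^p\in[0,\infty]$ for $f\in C(X)$, $D_p=\{f\in\ell^p(X,m): \mathcal{E}_p(f)<\infty\}$, and (for $m(X)<\infty$) $$\lambda^{(1)}_p=\inf_{f\in\ell^p(X,m),\ f\text{ non-constant}}\ \frac{\mathcal{E}_p(f)}{\inf_{\gamma\in\mathbb{R}}\|f-\gamma\|_{m,p}^p}.$$ A function $f\in D_p$ is a weak solution for $\lambda\in\mathbb R$ if for all $g\in D_p$ $$\frac12\sum_{x,y\in X}b(x,y)|f(x)-f(y)|^{p-2}(f(x)-f(y))(g(x)-g(y))=\lambda\sum_{x\in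 X}|f(x)|^{p-2}f(x)g(x)m(x),$$ where $|t|^{p-2}t$ is read as $0$ for $t=0$. For $p\in(1,\infty)$, $R_p(b,m)$ is the set of all symmetric functions $d:X\times X\to[0,\infty)$ such that $\sum_{y\in X}b(x,y)d(x,y)^{p/(p-1)}\le m(x)$ for all $x\in X$. For $W\subseteq X$, $\partial W=W\times(X\setminus W)$, and for $d:X\times X\to[0,\infty)$, $|\partial W|_{bd}=\sum_{(x,y)\in\partial W}b(x,y)d(x,y)\in[0,\infty]$. The isoperimetric constants are $$h^{(1)}(d)=\inf_{\emptyset\ne W\subseteq X,\ m(W)\le m(X)/2}\frac{|\partial W|_{bd}}{m(W)},\qquad h^{(1)}_p=\sup_{d\in R_p(b,m)}h^{(1)}(d).$$ -}

module Defs where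

open import Level using (0ℓ; suc)
open import Algebra.Bundles using (CommutativeRing)
open import Axiom.ExcludedMiddle using (ExcludedMiddle)
open import Data.Bool.Base using (Bool; T)
open import Data.Empty using (⊥-elim)
open import Data.List.Base using (List; foldr; map)
open import Data.List.Relation.Binary.Subset.Propositional using (_⊆_)
open import Data.List.Relation.Unary.All using (All)
open import Data.List.Relation.Unary.Unique.Propositional using (Unique)
open import Data.Product.Base using (∃-syntax; _×_; _,_; proj₁)
open import Function.Base using (flip; id; _∘_)
open import Relation.Binary.Bundles using (TotalOrder)
open import Relation.Binary.Core using (Rel)
open import Relation.Binary.PropositionalEquality.Core as ≡ using (_≡_)
open import Relation.Binary.Structures using (IsTotalOrder)
open import Relation.Nullary.Construct.Add.Extrema using (_±; ⊥±; ⊤±; [_])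
open import Relation.Nullary.Decidable.Core using (yes; no)
open import Relation.Nullary.Negation.Core using (¬_)
open import Relation.Unary using (Pred; U; ∁; _⟨×⟩_; Satisfiable)
import Algebra.Construct.NaturalChoice.Max as Max
import Relation.Binary.Construct.Add.Extrema.Equality as ExtremaEquality
import Relation.Binary.Construct.Add.Extrema.NonStrict as ExtremaOrder
import Relation.Binary.Construct.Add.Supremum.NonStrict as AddSupremum
import Relation.Binary.Construct.NonStrictToStrict as ToStrict

-- Supremum of the family (F i), i ∈ P; the empty family is allowed.
record IsSup {A I : Set} (_≤_ : Rel A 0ℓ)
             (P : Pred I 0ℓ) (F : I → A) (s : A) : Set where
  field
    bound : ∀ {i} → P i → F i ≤ s
    least : ∀ {t} → (∀ {i} → P i → F i ≤ t) → s ≤ t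

IsInf : {A I : Set} → Rel A 0ℓ → Pred I 0ℓ → (I → A) → A → Set
IsInf _≤_ = IsSup (flip _≤_)

-- The real numbers: up to unique isomorphism (given excluded middle) there is
-- exactly one such structure.
record CompleteOrderedField : Set (suc 0ℓ) where
  infix  4 _≤_
  infix  9 _⁻¹
  field
    commutativeRing : CommutativeRing 0ℓ 0ℓ
  open CommutativeRing commutativeRing public renaming (Carrier to ℝ)
  field
    1≉0          : ¬ (1# ≈ 0#)
    -- total function; its value at 0 is unconstrained
    _⁻¹          : ℝ → ℝ
    ⁻¹-cong      : ∀ {x y} → x ≈ y → x ⁻¹ ≈ y ⁻¹
    *-inverseʳ   : ∀ {x} → ¬ (x ≈ 0#) → x * x ⁻¹ ≈ 1#
    _≤_          : Rel ℝ 0ℓ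
    isTotalOrder : IsTotalOrder _≈_ _≤_
    +-monoˡ-≤    : ∀ {x y} z → x ≤ y → x + z ≤ y + z
    *-nonneg     : ∀ {x y} → 0# ≤ x → 0# ≤ y → 0# ≤ x * y
    complete     : (S : Pred ℝ 0ℓ) → Satisfiable S →
                   ∃[ u ] (∀ {x} → S x → x ≤ u) →
                   ∃[ s ] IsSup _≤_ S id s

  totalOrder : TotalOrder 0ℓ 0ℓ 0ℓ
  totalOrder = record { isTotalOrder = isTotalOrder }

  open ToStrict _≈_ _≤_ public using (_<_)
  open Max totalOrder public using (_⊔_)

  ∣_∣ : ℝ → ℝ
  ∣ x ∣ = x ⊔ (- x)

  2# : ℝ
  2# = 1# + 1#

-- Real powers of nonnegative bases.  The laws determine x ^ s uniquely for
-- x > 0 (for rational s by ^-1, ^-+ and ^-pos, then by ^-monoʳ), and 0 ^ s = 0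
-- for s > 0; all other values are unconstrained.
record RealPower (R : CompleteOrderedField) : Set where
  open CompleteOrderedField R
  infixr 8 _^_
  field
    _^_     : ℝ → ℝ → ℝ
    ^-cong  : ∀ {x y s t} → x ≈ y → s ≈ t → x ^ s ≈ y ^ t
    ^-pos   : ∀ {x} s → 0# < x → 0# < x ^ s
    ^-1     : ∀ {x} → 0# < x → x ^ 1# ≈ x
    ^-+     : ∀ {x} s t → 0# < x → x ^ (s + t) ≈ x ^ s * x ^ t
    ^-*     : ∀ {x} s t → 0# < x → x ^ (s * t) ≈ (x ^ s) ^ t
    *-^     : ∀ {x y} s → 0# < x → 0# < y → (x * y) ^ s ≈ x ^ s * y ^ s
    ^-monoʳ : ∀ {x s t} → 1# ≤ x → s ≤ t → x ^ s ≤ x ^ t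
    0^      : ∀ {s} → 0# < s → 0# ^ s ≈ 0#

module Analysis (em : ExcludedMiddle 0ℓ)
                (R : CompleteOrderedField) (Pow : RealPower R) where

  open CompleteOrderedField R public
  open RealPower Pow public

  ℝ± : Set
  ℝ± = ℝ ±

  open ExtremaEquality _≈_ public using (_≈±_)
  open ExtremaOrder _≤_ public using (_≤±_)

  private
    module O = IsTotalOrder isTotalOrder
    module E = ExtremaOrder _≤_

    [x]≰⊥ : ∀ {x} → ¬ ([ x ] ≤± ⊥±)
    [x]≰⊥ (AddSupremum.[_] ())

    supOfSet : (S : Pred ℝ± 0ℓ) → ∃[ s ] IsSup _≤±_ S id s
    supOfSet S with em {S ⊤±}
    ... | yes S⊤ = ⊤± , record { bound = λ _ → _ E.≤⊤± ; least = λ h → h S⊤ }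
    ... | no ¬S⊤ with em {∃[ x ] S [ x ]}
    ...   | no ∄x = ⊥± , record { bound = upper ; least = λ _ → E.⊥±≤ _ }
      where
      upper : ∀ {e} → S e → e ≤± ⊥±
      upper {⊥±}    _ = E.⊥±≤ _
      upper {[ x ]} p = ⊥-elim (∄x (x , p))
      upper {⊤±}    p = ⊥-elim (¬S⊤ p)
    ...   | yes (x₀ , Sx₀) with em {∃[ u ] (∀ {x} → S [ x ] → x ≤ u)}
    ...     | no ∄u = ⊤± , record { bound = λ _ → _ E.≤⊤± ; least = lower _ }
      where
      lower : ∀ t → (∀ {e} → S e → e ≤± t) → ⊤± ≤± t
      lower ⊥±    h = ⊥-elim ([x]≰⊥ (h Sx₀))
      lower [ y ] h = ⊥-elim (∄u (y , λ p → E.[≤]-injective (h p)))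
      lower ⊤±    h = _ E.≤⊤±
    ...     | yes bdd with complete (λ x → S [ x ]) (x₀ , Sx₀) bdd
    ...       | s , s-sup = [ s ] , record { bound = upper ; least = lower _ }
      where
      open IsSup s-sup
      upper : ∀ {e} → S e → e ≤± [ s ]
      upper {⊥±}    _ = E.⊥±≤ _
      upper {[ x ]} p = E.[ bound p ]
      upper {⊤±}    p = ⊥-elim (¬S⊤ p)
      lower : ∀ t → (∀ {e} → S e → e ≤± t) → [ s ] ≤± t
      lower ⊥±    h = ⊥-elim ([x]≰⊥ (h Sx₀))
      lower [ y ] h = E.[ least (λ p → E.[≤]-injective (h p)) ]
      lower ⊤±    h = _ E.≤⊤±

  sup-exists : {I : Set} (P : Pred I 0ℓ) (F : I → ℝ±) → ∃[ s ] IsSup _≤±_ P F s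
  sup-exists P F with supOfSet (λ e → ∃[ i ] (P i × F i ≡ e))
  ... | s , s-sup = s , record
    { bound = λ Pi → IsSup.bound s-sup (_ , Pi , ≡.refl)
    ; least = λ h → IsSup.least s-sup λ { (_ , Pi , ≡.refl) → h Pi }
    }

  inf-exists : {I : Set} (P : Pred I 0ℓ) (F : I → ℝ±) → ∃[ s ] IsInf _≤±_ P F s
  inf-exists P F with sup-exists (λ l → ∀ {i} → P i → l ≤± F i) id
  ... | s , s-sup = s , record
    { bound = λ Pi → IsSup.least s-sup (λ h → h Pi)
    ; least = λ h → IsSup.bound s-sup h
    }

  -- sup ∅ = -∞ and inf ∅ = +∞.
  sup inf : {I : Set} → Pred I 0ℓ → (I → ℝ±) → ℝ±
  sup P F = proj₁ (sup-exists P F)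
  inf P F = proj₁ (inf-exists P F)

  infix 4 _<∞
  _<∞ : ℝ± → Set
  e <∞ = ∃[ r ] e ≤± [ r ]

  -- The three operations below are only meaningful for c > 0, s > 0 and
  -- (for _÷_) a positive divisor; e / ∞ is 0.
  infixl 7 _·_ _÷_
  infixr 8 _^±_

  _·_ : ℝ → ℝ± → ℝ±
  c · ⊥±    = ⊥±
  c · [ x ] = [ c * x ]
  c · ⊤±    = ⊤±

  _÷_ : ℝ± → ℝ± → ℝ±
  e ÷ [ y ] = y ⁻¹ · e
  e ÷ ⊥±    = [ 0# ]
  e ÷ ⊤±    = [ 0# ]

  _^±_ : ℝ± → ℝ → ℝ±
  ⊥±    ^± s = ⊥±
  [ x ] ^± s = [ x ^ s ]
  ⊤±    ^± s = ⊤±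

  sumOver : {I : Set} → (I → ℝ) → List I → ℝ
  sumOver u xs = foldr _+_ 0# (map u xs)

  -- Sum over A of a nonnegative family: the supremum of its finite partial sums.
  ∑ : {I : Set} → Pred I 0ℓ → (I → ℝ) → ℝ±
  ∑ A u = sup (λ xs → Unique xs × All A xs) (λ xs → [ sumOver u xs ])

  -- Unconditional (equivalently, absolute) convergence, for families of
  -- arbitrary sign.
  HasSum : {I : Set} → (I → ℝ) → ℝ → Set
  HasSum u s = ∀ ε → 0# < ε →
    ∃[ xs ] (Unique xs × (∀ ys → Unique ys → xs ⊆ ys → ∣ sumOver u ys - s ∣ < ε))

  record Graph (X : Set) : Set where
    field
      b          : X → X → ℝ
      b-nonneg   : ∀ x y → 0# ≤ b x y
      b-sym      : ∀ x y → b x y ≈ b y x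
      b-diag     : ∀ x → b x x ≈ 0#
      b-summable : ∀ x → ∑ U (b x) <∞
      m          : X → ℝ
      m-pos      : ∀ x → 0# < m x

  NonConstant : {X : Set} → (X → ℝ) → Set
  NonConstant f = ∃[ x ] ∃[ y ] ¬ (f x ≈ f y)

  module _ {X : Set} (G : Graph X) where
    open Graph G

    -- Subsets are given by characteristic functions; by excluded middle these
    -- are all subsets, and, unlike Pred X 0ℓ, they form a type in Set.
    Subset : Set
    Subset = X → Bool

    ∂ : Subset → Pred (X × X) 0ℓ
    ∂ W = (T ∘ W) ⟨×⟩ ∁ (T ∘ W)

    mass : Pred X 0ℓ → ℝ±
    mass A = ∑ A m

    ∣∂_∣ : Subset → (X → X → ℝ) → ℝ±
    ∣∂ W ∣ d = ∑ (∂ W) (λ (x , y) → b x y * d x y)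

    h⁽¹⁾ : (X → X → ℝ) → ℝ±
    h⁽¹⁾ d = inf (λ W → Satisfiable (T ∘ W) × mass (T ∘ W) ≤± mass U ÷ [ 2# ])
                 (λ W → ∣∂ W ∣ d ÷ mass (T ∘ W))

    module _ (p : ℝ) where

      ‖_‖ : (X → ℝ) → ℝ±
      ‖ f ‖ = ∑ U (λ x → ∣ f x ∣ ^ p * m x) ^± (p ⁻¹)

      ℓᵖ : Pred (X → ℝ) 0ℓ
      ℓᵖ f = ‖ f ‖ <∞

      ℰ : (X → ℝ) → ℝ±
      ℰ f = ∑ {X × X} U (λ (x , y) → b x y * ∣ f x - f y ∣ ^ p) ÷ [ 2# ]

      D : Pred (X → ℝ) 0ℓ
      D f = ℓᵖ f × ℰ f <∞

      λ⁽¹⁾ : ℝ±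
      λ⁽¹⁾ = inf (λ f → ℓᵖ f × NonConstant f)
                 (λ f → ℰ f ÷ inf U (λ γ → ‖ (λ x → f x - γ) ‖ ^± p))

      -- |t|^(p-2) t; this is 0 at t = 0 whatever the value of 0 ^ (p - 2).
      φ : ℝ → ℝ
      φ t = ∣ t ∣ ^ (p - 2#) * t

      WeakSolution : ℝ → (X → ℝ) → Set
      WeakSolution μ f = D f × (∀ g → D g → ∃[ s ] ∃[ t ]
        ( HasSum {X × X} (λ (x , y) → b x y * φ (f x - f y) * (g x - g y)) s
        × HasSum (λ x → φ (f x) * g x * m x) t
        × 2# ⁻¹ * s ≈ μ * t ))

      Rₚ : Pred (X → X → ℝ) 0ℓ
      Rₚ d = (∀ x y → 0# ≤ d x y)
           × (∀ x y → d x y ≈ d y x)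
           × (∀ x → ∑ U (λ y → b x y * d x y ^ (p * (p - 1#) ⁻¹)) ≤± [ m x ])

      h⁽¹⁾ₚ : ℝ±
      h⁽¹⁾ₚ = sup Rₚ h⁽¹⁾

{-# OPTIONS --safe #-}

-- Testing the weak solution f with a nodal part g (f ⊔ 0 or f ⊓ 0, whichever
-- has support of mass at most m(X)/2) gives ℰ(g) ≤ μ ‖g‖ᵖ; if μ = 0, then f is
-- constant across edges and a level set of f has no boundary.  The co-area
-- inequality bounds h(d) ‖g‖ᵖ by ½ ∑ b d ||g(x)|ᵖ - |g(y)|ᵖ|.  For a ≥ b ≥ 0 and
-- u > 0,
--   d (aᵖ - bᵖ) ≤ u (a - b)ᵖ + (p - 1) u^(-1/(p-1)) d^(p/(p-1)) (aᵖ + bᵖ)/2,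
-- so, by the row condition on d, the sum is at most
--   (u μ + (p - 1) u^(-1/(p-1)) / 2) ‖g‖ᵖ,
-- and u = (2μ)^(1/p - 1) gives h(d) ≤ p (2μ)^(1/p) / 2.
--
-- There is no calculus behind the axioms for real powers: the convexity facts
-- (weighted AM-GM and the trapezoid inequality behind the displayed estimate)
-- hold because their defect has a supremum that is at most half of itself.

module Submission where

open import Defs
open import Level using (0ℓ)
open import Axiom.ExcludedMiddle using (ExcludedMiddle)
open import Data.Nat.Base as ℕ using (ℕ)
open import Function.Bundles using (_↣_)
open import Relation.Nullary.Construct.Add.Extrema using ([_])
open import Relation.Unary using (U)
open import Algebra.Bundles using (RawRing)
open import Algebra.Solver.Ring.AlmostCommutativeRing
  using (fromCommutativeRing; _-Raw-AlmostCommutative⟶_)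
open import Data.Bool.Base using (T)
open import Data.Empty using (⊥-elim)
open import Data.List.Base using (List; []; _∷_; _++_; map; filter; deduplicate; cartesianProduct)
open import Data.List.Membership.Propositional.Properties
  using (∈-∃++; ∈-++⁺ˡ; ∈-++⁺ʳ; ∈-++⁻; ∈-map⁺; ∈-deduplicate⁺; ∈-cartesianProduct⁺; ∈-filter⁻)
open import Data.List.Relation.Binary.Subset.Propositional using (_⊆_)
open import Data.List.Relation.Unary.All as All using (All; []; _∷_)
open import Data.List.Relation.Unary.All.Properties using (all-filter)
open import Data.List.Relation.Unary.AllPairs using ([]; _∷_)
open import Data.List.Relation.Unary.Any using (here; there)
open import Data.List.Relation.Unary.Unique.DecPropositional.Properties using (deduplicate-!)
open import Data.List.Relation.Unary.Unique.Propositional using (Unique)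
open import Data.Maybe.Base using (Maybe; just; nothing)
open import Data.Product.Base using (_×_; _,_; proj₁; proj₂; ∃-syntax; swap)
open import Data.Sum.Base using (_⊎_; inj₁; inj₂; [_,_]′)
open import Function.Base using (_∘_; id)
open import Relation.Binary.Definitions using (DecidableEquality)
open import Relation.Binary.PropositionalEquality.Core as ≡ using (_≡_)
open import Relation.Binary.Structures using (IsTotalOrder)
open import Relation.Nullary.Construct.Add.Extrema using (⊥±; ⊤±)
open import Relation.Nullary.Decidable.Core using (Dec; yes; no; isYes; toWitness; fromWitness)
open import Relation.Nullary.Negation.Core using (¬_)
open import Relation.Unary using (Pred)
import Algebra.Construct.NaturalChoice.Max as Max
import Algebra.Construct.NaturalChoice.Min as Min
import Algebra.Properties.AbelianGroup as AbelianGroupProperties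
import Algebra.Properties.CommutativeSemigroup as CommutativeSemigroupProperties
import Algebra.Properties.Ring as RingProperties
import Algebra.Properties.Semiring.Mult.TCOptimised as Multiples
import Algebra.Solver.Ring as RingSolver
import Data.List.Relation.Unary.Unique.Propositional.Properties as Unique
import Data.Nat.Properties as ℕ
import Relation.Binary.Construct.Add.Extrema.Equality as ExtremaEquality
import Relation.Binary.Construct.Add.Extrema.NonStrict as ExtremaOrder
import Relation.Binary.Construct.Add.Supremum.NonStrict as AddSupremum
import Relation.Binary.Construct.NonStrictToStrict as ToStrict
import Relation.Binary.Reasoning.Setoid as SetoidReasoning

-- The displayed estimate arises by integrating Young's inequality p c t^(p-1) ≤ c^p + (p-1) t^p
-- over [b, a] and replacing the integral of t^p by its trapezoid value. The trapezoid, rather than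
-- the cruder (a - b) a^p, accounts for the constant: the average of a^p and b^p charges both ends
-- of an edge equally, so the row condition produces ‖g‖ᵖ and not twice as much.
--
-- A nodal part is a useful test function only if it does not vanish. For μ > 0 this follows by
-- testing with constants, which lie in `D` because the total mass is finite: the m-weighted sum of
-- φ(f) is zero, so f takes both signs. This argument says nothing at μ = 0, hence the separate
-- case.
--
-- X and the boundary weights may be infinite, so sums are handled through bounds on finite partial
-- sums. This shapes the co-area inequality: at each level it consumes a finite list of boundary
-- edges, which is what the negation of h(d) ≤ c supplies. The bound on h(d) is therefore obtained
-- by contradiction from some c above it.

-- Ordered field arithmetic, a ring solver, absolute values

module OrderedField (R : CompleteOrderedField) where
  open CompleteOrderedField R hiding (refl; sym; trans)
  open CompleteOrderedField R public using ()
    renaming (refl to ≈-refl; sym to ≈-sym; trans to ≈-trans)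

  open RingProperties ring public using (-‿distribˡ-*; -‿distribʳ-*; -0#≈0#; -‿involutive)

  private
    module M = Multiples semiring
    open M using () renaming (_×_ to _×′_)

    -- Cancelling the common part leaves one component zero, so equal integers become the same pair
    -- and the solver's normal forms agree definitionally.
    normalise : ℕ × ℕ → ℕ × ℕ
    normalise (a , b) = a ℕ.∸ b , b ℕ.∸ a

    -- Integer coefficients as formal differences of naturals.
    coefficients : RawRing 0ℓ 0ℓ
    coefficients = record
      { Carrier = ℕ × ℕ
      ; _≈_ = _≡_
      ; _+_ = λ (a , b) (c , d) → normalise (a ℕ.+ c , b ℕ.+ d)
      ; _*_ = λ (a , b) (c , d) → normalise (a ℕ.* c ℕ.+ b ℕ.* d , a ℕ.* d ℕ.+ b ℕ.* c)
      ; -_ = λ (a , b) → b , a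
      ; 0# = 0 , 0
      ; 1# = 1 , 0
      }

    -- The case split makes ⟦ 0# ⟧ and ⟦ 1# ⟧ compute.
    ⟦_⟧ : ℕ × ℕ → ℝ
    ⟦ a , 0 ⟧       = a ×′ 1#
    ⟦ a , ℕ.suc b ⟧ = a ×′ 1# - ℕ.suc b ×′ 1#

    ⟦⟧-sub : ∀ a b → ⟦ a , b ⟧ ≈ a ×′ 1# - b ×′ 1#
    ⟦⟧-sub a 0         = ≈-sym (≈-trans (+-congˡ -0#≈0#) (+-identityʳ _))
    ⟦⟧-sub a (ℕ.suc b) = ≈-refl

    open SetoidReasoning setoid
    open AbelianGroupProperties +-abelianGroup using (⁻¹-∙-comm)
    open CommutativeSemigroupProperties +-commutativeSemigroup using (interchange)

    sub-+ : ∀ a b c d → (a + c) - (b + d) ≈ (a - b) + (c - d)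
    sub-+ a b c d = begin
      (a + c) - (b + d)         ≈⟨ +-congˡ (⁻¹-∙-comm b d) ⟨
      (a + c) + (- b + - d)     ≈⟨ interchange a c (- b) (- d) ⟩
      (a - b) + (c - d)         ∎

    neg-sub : ∀ a b → - (a - b) ≈ b - a
    neg-sub a b = begin
      - (a - b)     ≈⟨ ⁻¹-∙-comm a (- b) ⟨
      - a + - - b   ≈⟨ +-congˡ (-‿involutive b) ⟩
      - a + b       ≈⟨ +-comm _ _ ⟩
      b - a         ∎

    sub-* : ∀ a b c d → (a * c + b * d) - (a * d + b * c) ≈ (a - b) * (c - d)
    sub-* a b c d = begin
      (a * c + b * d) - (a * d + b * c)     ≈⟨ sub-+ _ _ _ _ ⟩
      (a * c - a * d) + (b * d - b * c)     ≈⟨ +-congˡ (neg-sub _ _) ⟨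
      (a * c - a * d) - (b * c - b * d)     ≈⟨ +-cong (+-congˡ (-‿distribʳ-* a d))
          (-‿cong (+-congˡ (-‿distribʳ-* b d))) ⟩
      (a * c + a * - d) - (b * c + b * - d) ≈⟨ +-cong (distribˡ a c (- d)) (-‿cong (distribˡ b c (- d))) ⟨
      a * (c - d) - b * (c - d)             ≈⟨ +-congˡ (-‿distribˡ-* b (c - d)) ⟩
      a * (c - d) + - b * (c - d)           ≈⟨ distribʳ (c - d) a (- b) ⟨
      (a - b) * (c - d)                     ∎

    ⟦⟧-≡ : ∀ {a b c d} → a ℕ.+ d ≡ c ℕ.+ b → ⟦ a , b ⟧ ≈ ⟦ c , d ⟧
    ⟦⟧-≡ {a} {b} {c} {d} a+d = begin
      ⟦ a , b ⟧                    ≈⟨ ⟦⟧-sub a b ⟩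
      a′ - b′                      ≈⟨ add-cancel a′ b′ d′ ⟩
      (a′ + d′) - (b′ + d′)        ≈⟨ +-congʳ (M.×-homo-+ 1# a d) ⟨
      (a ℕ.+ d) ×′ 1# - (b′ + d′)  ≡⟨ ≡.cong (λ n → n ×′ 1# - (b′ + d′)) a+d ⟩
      (c ℕ.+ b) ×′ 1# - (b′ + d′)  ≈⟨ +-cong (M.×-homo-+ 1# c b) (-‿cong (+-comm b′ d′)) ⟩
      (c′ + b′) - (d′ + b′)        ≈⟨ add-cancel c′ d′ b′ ⟨
      c′ - d′                      ≈⟨ ⟦⟧-sub c d ⟨
      ⟦ c , d ⟧                    ∎
      where
      a′ b′ c′ d′ : ℝ
      a′ = a ×′ 1#
      b′ = b ×′ 1#
      c′ = c ×′ 1#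
      d′ = d ×′ 1#
      add-cancel : ∀ x y z → x - y ≈ (x + z) - (y + z)
      add-cancel x y z = begin
        x - y              ≈⟨ +-identityʳ _ ⟨
        (x - y) + 0#       ≈⟨ +-congˡ (-‿inverseʳ z) ⟨
        (x - y) + (z - z)  ≈⟨ sub-+ x y z z ⟨
        (x + z) - (y + z)  ∎

    ⟦⟧-normalise : ∀ a b → ⟦ normalise (a , b) ⟧ ≈ a ×′ 1# - b ×′ 1#
    ⟦⟧-normalise a b = ≈-trans (⟦⟧-≡ {a ℕ.∸ b} {b ℕ.∸ a} (∸-+ a b)) (⟦⟧-sub a b)
      where
      ∸-+ : ∀ a b → (a ℕ.∸ b) ℕ.+ b ≡ a ℕ.+ (b ℕ.∸ a)
      ∸-+ ℕ.zero    b         = ≡.cong (ℕ._+ b) (ℕ.0∸n≡0 b)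
      ∸-+ (ℕ.suc a) ℕ.zero    = ≡.refl
      ∸-+ (ℕ.suc a) (ℕ.suc b) = ≡.trans (ℕ.+-suc (a ℕ.∸ b) b) (≡.cong ℕ.suc (∸-+ a b))

    ⟦⟧-≟ : ∀ x y → Maybe (⟦ x ⟧ ≈ ⟦ y ⟧)
    ⟦⟧-≟ (a , b) (c , d) with a ℕ.+ d ℕ.≟ c ℕ.+ b
    ... | no _  = nothing
    ... | yes p = just (⟦⟧-≡ {a} {b} {c} {d} p)

    morphism : coefficients -Raw-AlmostCommutative⟶ fromCommutativeRing commutativeRing
    morphism = record
      { ⟦_⟧ = ⟦_⟧
      ; +-homo = λ (a , b) (c , d) → begin
          ⟦ normalise (a ℕ.+ c , b ℕ.+ d) ⟧          ≈⟨ ⟦⟧-normalise (a ℕ.+ c) (b ℕ.+ d) ⟩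
          (a ℕ.+ c) ×′ 1# - (b ℕ.+ d) ×′ 1#          ≈⟨ +-cong (M.×-homo-+ 1# a c)
              (-‿cong (M.×-homo-+ 1# b d)) ⟩
          (a ×′ 1# + c ×′ 1#) - (b ×′ 1# + d ×′ 1#)  ≈⟨ sub-+ _ _ _ _ ⟩
          (a ×′ 1# - b ×′ 1#) + (c ×′ 1# - d ×′ 1#)  ≈⟨ +-cong (⟦⟧-sub a b) (⟦⟧-sub c d) ⟨
          ⟦ a , b ⟧ + ⟦ c , d ⟧                      ∎
      ; *-homo = λ (a , b) (c , d) → begin
          ⟦ normalise (a ℕ.* c ℕ.+ b ℕ.* d , a ℕ.* d ℕ.+ b ℕ.* c) ⟧
            ≈⟨ ⟦⟧-normalise (a ℕ.* c ℕ.+ b ℕ.* d) (a ℕ.* d ℕ.+ b ℕ.* c) ⟩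
          (a ℕ.* c ℕ.+ b ℕ.* d) ×′ 1# - (a ℕ.* d ℕ.+ b ℕ.* c) ×′ 1#
            ≈⟨ +-cong (×-+-* a c b d) (-‿cong (×-+-* a d b c)) ⟩
          (a ×′ 1# * c ×′ 1# + b ×′ 1# * d ×′ 1#) - (a ×′ 1# * d ×′ 1# + b ×′ 1# * c ×′ 1#)
            ≈⟨ sub-* _ _ _ _ ⟩
          (a ×′ 1# - b ×′ 1#) * (c ×′ 1# - d ×′ 1#)      ≈⟨ *-cong (⟦⟧-sub a b) (⟦⟧-sub c d) ⟨
          ⟦ a , b ⟧ * ⟦ c , d ⟧                          ∎
      ; -‿homo = λ (a , b) → begin
          ⟦ b , a ⟧              ≈⟨ ⟦⟧-sub b a ⟩
          b ×′ 1# - a ×′ 1#      ≈⟨ neg-sub _ _ ⟨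
          - (a ×′ 1# - b ×′ 1#)  ≈⟨ -‿cong (⟦⟧-sub a b) ⟨
          - ⟦ a , b ⟧            ∎
      ; 0-homo = ≈-refl
      ; 1-homo = ≈-refl
      }
      where
      ×-+-* : ∀ a c b d → (a ℕ.* c ℕ.+ b ℕ.* d) ×′ 1# ≈ a ×′ 1# * c ×′ 1# + b ×′ 1# * d ×′ 1#
      ×-+-* a c b d = ≈-trans (M.×-homo-+ 1# (a ℕ.* c) (b ℕ.* d))
                              (+-cong (M.×1-homo-* a c) (M.×1-homo-* b d))

  module Solver = RingSolver coefficients (fromCommutativeRing commutativeRing) morphism ⟦⟧-≟
  open Solver public using (solve; _:=_; _:+_; _:*_; _:-_; :-_; con)

  :1 : ∀ {n : ℕ} → Solver.Polynomial n
  :1 = con (1 , 0)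
  :0 : ∀ {n : ℕ} → Solver.Polynomial n
  :0 = con (0 , 0)

  open IsTotalOrder isTotalOrder public using (antisym; total)
    renaming (trans to ≤-trans; reflexive to ≤-reflexive; refl to ≤-refl)
  open IsTotalOrder isTotalOrder using (≤-resp-≈)

  private module S = ToStrict _≈_ _≤_

  ≰⇒> : ∀ {x y} → ¬ (x ≤ y) → y < x
  ≰⇒> = S.≰⇒> ≈-sym ≤-reflexive total

  <⇒≱ : ∀ {x y} → x < y → ¬ (y ≤ x)
  <⇒≱ = S.<⇒≱ antisym

  <⇒≤ : ∀ {x y} → x < y → x ≤ y
  <⇒≤ = proj₁

  <-≤-trans : ∀ {x y z} → x < y → y ≤ z → x < z
  <-≤-trans = S.<-≤-trans ≈-sym ≤-trans antisym (proj₁ ≤-resp-≈)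

  ≤-<-trans : ∀ {x y z} → x ≤ y → y < z → x < z
  ≤-<-trans = S.≤-<-trans ≤-trans antisym (proj₂ ≤-resp-≈)

  <-respʳ : ∀ {x y z} → y ≈ z → x < y → x < z
  <-respʳ y≈z x<y = <-≤-trans x<y (≤-reflexive y≈z)

  0≤-⇒≤ : ∀ {x y} → 0# ≤ y - x → x ≤ y
  0≤-⇒≤ {x} {y} p = ≤-trans (≤-reflexive (≈-sym (+-identityˡ x)))
    (≤-trans (+-monoˡ-≤ x p) (≤-reflexive (solve 2 (λ x y → (y :- x) :+ x := y) ≈-refl x y)))

  ≤⇒0≤- : ∀ {x y} → x ≤ y → 0# ≤ y - x
  ≤⇒0≤- {x} p = ≤-trans (≤-reflexive (≈-sym (-‿inverseʳ x))) (+-monoˡ-≤ (- x) p)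

  +-mono-≤ : ∀ {a b c d} → a ≤ b → c ≤ d → a + c ≤ b + d
  +-mono-≤ {a} {b} {c} {d} a≤b c≤d = ≤-trans (+-monoˡ-≤ c a≤b)
    (≤-trans (≤-reflexive (+-comm b c)) (≤-trans (+-monoˡ-≤ b c≤d) (≤-reflexive (+-comm d b))))

  +-nonneg : ∀ {a b} → 0# ≤ a → 0# ≤ b → 0# ≤ a + b
  +-nonneg p q = ≤-trans (≤-reflexive (≈-sym (+-identityˡ 0#))) (+-mono-≤ p q)

  -- Inequalities are derived as nonnegative combinations of known ones; the
  -- side condition is a ring identity.
  ≤-by : ∀ {a b x y} → a ≤ b → y - x ≈ b - a → x ≤ y
  ≤-by p e = 0≤-⇒≤ (≤-trans (≤⇒0≤- p) (≤-reflexive (≈-sym e)))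

  ≤-by₂ : ∀ {a b c d x y} → a ≤ b → c ≤ d → y - x ≈ (b - a) + (d - c) → x ≤ y
  ≤-by₂ p q e = 0≤-⇒≤ (≤-trans (+-nonneg (≤⇒0≤- p) (≤⇒0≤- q)) (≤-reflexive (≈-sym e)))

  ≤-by₃ : ∀ {a b c d a′ b′ x y} → a ≤ b → c ≤ d → a′ ≤ b′ →
          y - x ≈ (b - a) + (d - c) + (b′ - a′) → x ≤ y
  ≤-by₃ p q r e = 0≤-⇒≤
    (≤-trans (+-nonneg (+-nonneg (≤⇒0≤- p) (≤⇒0≤- q)) (≤⇒0≤- r)) (≤-reflexive (≈-sym e)))

  0<-⇒< : ∀ {x y} → 0# < y - x → x < y
  0<-⇒< {x} p = 0≤-⇒≤ (<⇒≤ p) ,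
    λ x≈y → proj₂ p (≈-trans (≈-sym (-‿inverseʳ x)) (+-congʳ x≈y))

  <⇒0<- : ∀ {x y} → x < y → 0# < y - x
  <⇒0<- {x} {y} p = ≤⇒0≤- (<⇒≤ p) , λ e → proj₂ p (≈-trans (≈-sym (+-identityˡ x))
    (≈-trans (+-congʳ e) (solve 2 (λ x y → (y :- x) :+ x := y) ≈-refl x y)))

  +-pos-nonneg : ∀ {a b} → 0# < a → 0# ≤ b → 0# < a + b
  +-pos-nonneg p q = <-≤-trans p (≤-by q (solve 2 (λ a b → (a :+ b) :- a := b :- :0) ≈-refl _ _))

  <-by : ∀ {a b x y} → a < b → y - x ≈ b - a → x < y
  <-by p e = 0<-⇒< (<-respʳ (≈-sym e) (<⇒0<- p))

  +-pos : ∀ {a b} → 0# < a → 0# < b → 0# < a + b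
  +-pos p q = +-pos-nonneg p (<⇒≤ q)

  neg-mono-≤ : ∀ {x y} → x ≤ y → - y ≤ - x
  neg-mono-≤ p = ≤-by p (solve 2 (λ x y → (:- x) :- (:- y) := y :- x) ≈-refl _ _)

  0≤1 : 0# ≤ 1#
  0≤1 with total 0# 1#
  ... | inj₁ p = p
  ... | inj₂ p = ≤-trans (*-nonneg q q) (≤-reflexive (solve 0 ((:- :1) :* (:- :1) := :1) ≈-refl))
    where
    q : 0# ≤ - 1#
    q = ≤-by p (solve 0 ((:- :1) :- :0 := :0 :- :1) ≈-refl)

  0<1 : 0# < 1#
  0<1 = 0≤1 , λ e → 1≉0 (≈-sym e)

  0<2 : 0# < 2#
  0<2 = +-pos 0<1 0<1

  >⇒≉0 : ∀ {x} → 0# < x → ¬ (x ≈ 0#)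
  >⇒≉0 p e = proj₂ p (≈-sym e)

  *-⁻¹ : ∀ {x} → 0# < x → x * x ⁻¹ ≈ 1#
  *-⁻¹ p = *-inverseʳ (>⇒≉0 p)

  *-pos : ∀ {x y} → 0# < x → 0# < y → 0# < x * y
  *-pos {x} {y} p q = *-nonneg (<⇒≤ p) (<⇒≤ q) , λ e → proj₂ q (begin
    0#               ≈⟨ zeroʳ (x ⁻¹) ⟨
    x ⁻¹ * 0#        ≈⟨ *-congˡ e ⟩
    x ⁻¹ * (x * y)   ≈⟨ solve 3 (λ i x y → i :* (x :* y) := (x :* i) :* y) ≈-refl _ x y ⟩
    (x * x ⁻¹) * y   ≈⟨ *-congʳ (*-⁻¹ p) ⟩
    1# * y           ≈⟨ *-identityˡ y ⟩
    y                ∎)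

  *-monoˡ-≤ : ∀ {x y z} → 0# ≤ z → x ≤ y → z * x ≤ z * y
  *-monoˡ-≤ {x} {y} {z} p q = 0≤-⇒≤ (≤-trans (*-nonneg p (≤⇒0≤- q))
    (≤-reflexive (solve 3 (λ x y z → z :* (y :- x) := z :* y :- z :* x) ≈-refl x y z)))

  *-monoʳ-≤ : ∀ {x y z} → 0# ≤ z → x ≤ y → x * z ≤ y * z
  *-monoʳ-≤ {x} {y} {z} p q = ≤-trans (≤-reflexive (*-comm x z))
    (≤-trans (*-monoˡ-≤ p q) (≤-reflexive (*-comm z y)))

  *-monoˡ-< : ∀ {x y z} → 0# < z → x < y → z * x < z * y
  *-monoˡ-< {x} {y} {z} p q = 0<-⇒< (<-respʳ
    (solve 3 (λ x y z → z :* (y :- x) := z :* y :- z :* x) ≈-refl x y z) (*-pos p (<⇒0<- q)))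

  *-cancelˡ-≤ : ∀ {x y z} → 0# < z → z * x ≤ z * y → x ≤ y
  *-cancelˡ-≤ {x} {y} {z} p q with total x y
  ... | inj₁ x≤y = x≤y
  ... | inj₂ y≤x = ≤-reflexive (begin
    x               ≈⟨ insert x ⟩
    z ⁻¹ * (z * x)  ≈⟨ *-congˡ (antisym q (*-monoˡ-≤ (<⇒≤ p) y≤x)) ⟩
    z ⁻¹ * (z * y)  ≈⟨ insert y ⟨
    y               ∎)
    where
    insert : ∀ w → w ≈ z ⁻¹ * (z * w)
    insert w = begin
      w                ≈⟨ *-identityˡ w ⟨
      1# * w           ≈⟨ *-congʳ (*-⁻¹ p) ⟨
      (z * z ⁻¹) * w   ≈⟨ solve 3 (λ z i w → (z :* i) :* w := i :* (z :* w)) ≈-refl z _ w ⟩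
      z ⁻¹ * (z * w)   ∎

  *-cancelˡ-≈ : ∀ {x y z} → 0# < z → z * x ≈ z * y → x ≈ y
  *-cancelˡ-≈ p e = antisym (*-cancelˡ-≤ p (≤-reflexive e)) (*-cancelˡ-≤ p (≤-reflexive (≈-sym e)))

  ⁻¹-pos : ∀ {x} → 0# < x → 0# < x ⁻¹
  ⁻¹-pos {x} p = ≰⇒> λ q → <⇒≱ 0<1 (≤-by
    (*-monoˡ-≤ (<⇒≤ p) q)
    (≈-trans (+-congˡ (-‿cong (≈-sym (*-⁻¹ p)))) (solve 2 (λ x i → :0 :- x :* i
        := x :* :0 :- x :* i) ≈-refl x _)))

  quotient : ∀ x {y} → 0# < y → y * (x * y ⁻¹) ≈ x
  quotient x {y} p = begin
    y * (x * y ⁻¹)   ≈⟨ solve 3 (λ x y i → y :* (x :* i) := (y :* i) :* x) ≈-refl x y (y ⁻¹) ⟩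
    (y * y ⁻¹) * x   ≈⟨ *-congʳ (*-⁻¹ p) ⟩
    1# * x           ≈⟨ *-identityˡ x ⟩
    x                ∎

  0≤x*x : ∀ x → 0# ≤ x * x
  0≤x*x x with total 0# x
  ... | inj₁ p = *-nonneg p p
  ... | inj₂ p = ≤-trans (*-nonneg q q) (≤-reflexive (solve 1 (λ x → (:- x) :* (:- x) := x :* x) ≈-refl x))
    where
    q : 0# ≤ - x
    q = ≤-by p (solve 1 (λ x → (:- x) :- :0 := :0 :- x) ≈-refl x)

  ½ : ℝ
  ½ = 2# ⁻¹

  0<½ : 0# < ½
  0<½ = ⁻¹-pos 0<2

  0≤½ : 0# ≤ ½
  0≤½ = <⇒≤ 0<½

  ½+½ : ∀ x → ½ * x + ½ * x ≈ x
  ½+½ x = begin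
    ½ * x + ½ * x   ≈⟨ solve 2 (λ h x → h :* x :+ h :* x := ((:1 :+ :1) :* h) :* x) ≈-refl ½ x ⟩
    (2# * ½) * x    ≈⟨ *-congʳ (*-⁻¹ 0<2) ⟩
    1# * x          ≈⟨ *-identityˡ x ⟩
    x               ∎

  dense : ∀ {x y} → x < y → ∃[ z ] (x < z × z < y)
  dense {x} {y} p = ½ * (x + y)
    , <-by q (≈-trans (+-congˡ (-‿cong (≈-sym (½+½ x))))
        (solve 3 (λ h x y → h :* (x :+ y) :- (h :* x :+ h :* x) := h :* y :- h :* x) ≈-refl ½ x y))
    , <-by q (≈-trans (+-congʳ (≈-sym (½+½ y)))
        (solve 3 (λ h x y → (h :* y :+ h :* y) :- h :* (x :+ y) := h :* y :- h :* x) ≈-refl ½ x y))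
    where
    q : ½ * x < ½ * y
    q = *-monoˡ-< 0<½ p

  -- Totality alone does not turn a refuted strict inequality into a weak one; a decision is needed,
  -- and `ClassicalOrder` supplies it from excluded middle.
  module WithDecidableOrder (_≤?_ : ∀ x y → Dec (x ≤ y)) where

    ≮⇒≥ : ∀ {x y} → ¬ (x < y) → y ≤ x
    ≮⇒≥ {x} {y} h with y ≤? x
    ... | yes p = p
    ... | no ¬p = ⊥-elim (h (≰⇒> ¬p))

    x≤y+ε⇒x≤y : ∀ {x y} → (∀ ε → 0# < ε → x ≤ y + ε) → x ≤ y
    x≤y+ε⇒x≤y {x} {y} h = ≮⇒≥ λ y<x → let (z , y<z , z<x) = dense y<x in
      <⇒≱ z<x (≤-trans (h (z - y) (<⇒0<- y<z))
        (≤-reflexive (solve 2 (λ y z → y :+ (z :- y) := z) ≈-refl y z)))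

  open Max totalOrder public using (x≤y⇒x⊔y≈y; x≤y⇒y⊔x≈y; x≤x⊔y; x≤y⊔x; ⊔-lub; ⊔-cong)
  open Min totalOrder public using (_⊓_; x≤y⇒x⊓y≈x; x≤y⇒y⊓x≈x; x⊓y≤x; x⊓y≤y; ⊓-glb)

  0≤x⇒∣x∣≈x : ∀ {x} → 0# ≤ x → ∣ x ∣ ≈ x
  0≤x⇒∣x∣≈x {x} p = x≤y⇒y⊔x≈y (≤-trans (≤-by p (solve 1 (λ x → :0 :- (:- x) := x :- :0) ≈-refl x)) p)

  x≤0⇒∣x∣≈-x : ∀ {x} → x ≤ 0# → ∣ x ∣ ≈ - x
  x≤0⇒∣x∣≈-x {x} p = x≤y⇒x⊔y≈y (≤-trans p (≤-by p (solve 1 (λ x → (:- x) :- :0 := :0 :- x) ≈-refl x)))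

  ∣∣-cong : ∀ {x y} → x ≈ y → ∣ x ∣ ≈ ∣ y ∣
  ∣∣-cong {x} {y} e with total 0# x
  ... | inj₁ p = ≈-trans (0≤x⇒∣x∣≈x p) (≈-trans e (≈-sym (0≤x⇒∣x∣≈x (≤-trans p (≤-reflexive e)))))
  ... | inj₂ p = ≈-trans (x≤0⇒∣x∣≈-x p)
    (≈-trans (-‿cong e) (≈-sym (x≤0⇒∣x∣≈-x (≤-trans (≤-reflexive (≈-sym e)) p))))

  0≤∣x∣ : ∀ x → 0# ≤ ∣ x ∣
  0≤∣x∣ x with total 0# x
  ... | inj₁ p = ≤-trans p (≤-reflexive (≈-sym (0≤x⇒∣x∣≈x p)))
  ... | inj₂ p = ≤-trans (≤-trans (≤-reflexive (≈-sym -0#≈0#)) (neg-mono-≤ p))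
                         (≤-reflexive (≈-sym (x≤0⇒∣x∣≈-x p)))

  x≤∣x∣ : ∀ x → x ≤ ∣ x ∣
  x≤∣x∣ x with total 0# x
  ... | inj₁ p = ≤-reflexive (≈-sym (0≤x⇒∣x∣≈x p))
  ... | inj₂ p = ≤-trans p (0≤∣x∣ x)

  ∣-x∣≈∣x∣ : ∀ x → ∣ - x ∣ ≈ ∣ x ∣
  ∣-x∣≈∣x∣ x with total 0# x
  ... | inj₁ p = ≈-trans (x≤0⇒∣x∣≈-x (≤-trans (neg-mono-≤ p) (≤-reflexive -0#≈0#)))
                 (≈-trans (-‿involutive x) (≈-sym (0≤x⇒∣x∣≈x p)))
  ... | inj₂ p = ≈-trans (0≤x⇒∣x∣≈x (≤-trans (≤-reflexive (≈-sym -0#≈0#)) (neg-mono-≤ p)))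
                         (≈-sym (x≤0⇒∣x∣≈-x p))

  -x≤∣x∣ : ∀ x → - x ≤ ∣ x ∣
  -x≤∣x∣ x = ≤-trans (x≤∣x∣ (- x)) (≤-reflexive (∣-x∣≈∣x∣ x))

  ∣x∣≤ : ∀ {x y} → x ≤ y → - x ≤ y → ∣ x ∣ ≤ y
  ∣x∣≤ {x} p q with total 0# x
  ... | inj₁ r = ≤-trans (≤-reflexive (0≤x⇒∣x∣≈x r)) p
  ... | inj₂ r = ≤-trans (≤-reflexive (x≤0⇒∣x∣≈-x r)) q

  ∣x-y∣≈∣y-x∣ : ∀ x y → ∣ x - y ∣ ≈ ∣ y - x ∣
  ∣x-y∣≈∣y-x∣ x y = ≈-trans (∣∣-cong (solve 2 (λ x y → x :- y := :- (y :- x)) ≈-refl x y)) (∣-x∣≈∣x∣ (y - x))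

  ∣∣x∣-∣y∣∣≤∣x-y∣ : ∀ x y → ∣ ∣ x ∣ - ∣ y ∣ ∣ ≤ ∣ x - y ∣
  ∣∣x∣-∣y∣∣≤∣x-y∣ x y = ∣x∣≤ (below x y)
    (≤-trans (≤-reflexive (solve 2 (λ a b → :- (a :- b) := b :- a) ≈-refl ∣ x ∣ ∣ y ∣))
      (≤-trans (below y x) (≤-reflexive (∣x-y∣≈∣y-x∣ y x))))
    where
    below : ∀ x y → ∣ x ∣ - ∣ y ∣ ≤ ∣ x - y ∣
    below x y = ≤-by (∣x∣≤ {x} {∣ x - y ∣ + ∣ y ∣}
        (≤-by₂ (x≤∣x∣ (x - y)) (x≤∣x∣ y)
          (solve 4 (λ a b x y → (a :+ b) :- x := (a :- (x :- y)) :+ (b :- y)) ≈-refl _ _ x y))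
        (≤-by₂ (-x≤∣x∣ (x - y)) (-x≤∣x∣ y)
          (solve 4 (λ a b x y → (a :+ b) :- (:- x) := (a :- (:- (x :- y))) :+ (b :- (:- y))) ≈-refl _ _ x y)))
      (solve 3 (λ a b c → c :- (a :- b) := (c :+ b) :- a) ≈-refl _ _ _)

-- Suprema and continuous induction

module ClassicalOrder (em : ExcludedMiddle 0ℓ) (R : CompleteOrderedField) where
  open CompleteOrderedField R hiding (refl; sym; trans)
  open OrderedField R
  open WithDecidableOrder (λ _ _ → em) public

  0≤⇒≈0⊎> : ∀ {x} → 0# ≤ x → x ≈ 0# ⊎ 0# < x
  0≤⇒≈0⊎> {x} p with em {x ≈ 0#}
  ... | yes e = inj₁ e
  ... | no ¬e = inj₂ (p , λ e → ¬e (≈-sym e))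

  ≤½-self : ∀ {x} → x ≤ ½ * x → x ≤ 0#
  ≤½-self {x} p = ≤-by₂ p p (begin
    0# - x                           ≈⟨ +-congˡ (-‿cong (½+½ x)) ⟨
    0# - (y + y)                     ≈⟨ solve 1 (λ y → :0 :- (y :+ y)
        := (y :+ y) :- ((y :+ y) :+ (y :+ y))) ≈-refl y ⟩
    (y + y) - ((y + y) + (y + y))    ≈⟨ +-congˡ (-‿cong (+-cong (½+½ x) (½+½ x))) ⟩
    (y + y) - (x + x)                ≈⟨ solve 2 (λ x y → (y :+ y) :- (x :+ x)
        := (y :- x) :+ (y :- x)) ≈-refl x y ⟩
    (y - x) + (y - x)                ∎)
    where
    open SetoidReasoning setoid
    y : ℝ
    y = ½ * x

  -- The bound `K` serves the existence of the supremum, so any crude estimate will do. The halving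
  -- hypothesis ranges over all upper bounds `t` in order to be applied at the supremum itself.
  sup-halving : {I : Set} (P : Pred I 0ℓ) (F : I → ℝ) → ∃[ K ] (∀ {i} → P i → F i ≤ K) →
    (∀ t → (∀ {j} → P j → F j ≤ t) → ∀ {i} → P i → F i ≤ ½ * t) →
    ∀ {i} → P i → F i ≤ 0#
  sup-halving P F (K , bounded) halve {i} Pi
    with complete (λ y → ∃[ j ] (P j × y ≈ F j)) (F i , i , Pi , ≈-refl)
           (K , λ (j , Pj , e) → ≤-trans (≤-reflexive e) (bounded Pj))
  ... | s , s-sup = ≤-trans (upper Pi) (≤½-self
          (IsSup.least s-sup λ (j , Pj , e) → ≤-trans (≤-reflexive e) (halve s upper Pj)))
    where
    upper : ∀ {j} → P j → F j ≤ s
    upper Pj = IsSup.bound s-sup (_ , Pj , ≈-refl)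

  x≤y+εk⇒x≤y : ∀ {x y k} → 0# ≤ k → (∀ ε → 0# < ε → x ≤ y + ε * k) → x ≤ y
  x≤y+εk⇒x≤y {x} {y} {k} 0≤k h = x≤y+ε⇒x≤y λ ε 0<ε →
    -- Division by `k + 1#` and not by `k`, which may be zero.
    ≤-trans (h (ε * (k + 1#) ⁻¹) (*-pos 0<ε (⁻¹-pos 0<k+1))) (+-mono-≤ ≤-refl (scaled ε 0<ε))
    where
    0<k+1 : 0# < k + 1#
    0<k+1 = <-respʳ (+-comm 1# k) (+-pos-nonneg 0<1 0≤k)
    scaled : ∀ ε → 0# < ε → ε * (k + 1#) ⁻¹ * k ≤ ε
    scaled ε 0<ε = ≤-by (<⇒≤ (*-pos 0<ε (⁻¹-pos 0<k+1))) (≈-trans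
      (+-congʳ (≈-sym (quotient ε 0<k+1)))
      (solve 2 (λ k d → (k :+ :1) :* d :- d :* k := d :- :0) ≈-refl k (ε * (k + 1#) ⁻¹)))

  sup-approximated : {S : Pred ℝ 0ℓ} {s : ℝ} → IsSup _≤_ S id s → ∀ ε → 0# < ε → ∃[ x ] (S x × s ≤ x + ε)
  sup-approximated {S} {s} s-sup ε 0<ε with em {∃[ x ] (S x × s ≤ x + ε)}
  ... | yes p = p
  ... | no ¬p = ⊥-elim (<⇒≱ 0<ε (≤-by (IsSup.least s-sup {s - ε} below)
          (solve 2 (λ e s → :0 :- e := s :- e :- s) ≈-refl ε s)))
    where
    below : ∀ {x} → S x → x ≤ s - ε
    below {x} Sx = ≤-by (<⇒≤ (≰⇒> λ q → ¬p (x , Sx , q)))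
      (solve 3 (λ x e s → s :- e :- x := s :- (x :+ e)) ≈-refl x ε s)

  -- The supremum of `S` belongs to `S` by closedness; below `top` it could be advanced to a larger
  -- member.
  continuous-induction : (S : Pred ℝ 0ℓ) {x top : ℝ} → S x → (∀ {x} → S x → x ≤ top) →
    (∀ {s} → IsSup _≤_ S id s → S s) → (∀ {s} → S s → s < top → ∃[ η ] (0# < η × S (s + η))) →
    ∃[ s ] (S s × top ≤ s)
  continuous-induction S {x} {top} Sx S≤top closed advance with complete S (x , Sx) (top , S≤top)
  ... | s , s-sup with em {top ≤ s}
  ...   | yes top≤s = s , closed s-sup , top≤s
  ...   | no  top≰s = let (η , 0<η , Ss+η) = advance (closed s-sup) (≰⇒> top≰s) in
          ⊥-elim (<⇒≱ 0<η (≤-by (IsSup.bound s-sup Ss+η) (solve 2 (λ s n → :0 :- n := s :- (s :+ n))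
              ≈-refl s η)))

-- Real powers and the weighted AM-GM inequality

module Powers (em : ExcludedMiddle 0ℓ) (R : CompleteOrderedField) (Pow : RealPower R) where
  open CompleteOrderedField R hiding (refl; sym; trans)
  open OrderedField R
  open ClassicalOrder em R
  open RealPower Pow
  open SetoidReasoning setoid

  ^-congˡ : ∀ {x y s} → x ≈ y → x ^ s ≈ y ^ s
  ^-congˡ e = ^-cong e ≈-refl

  ^-congʳ : ∀ {x s t} → s ≈ t → x ^ s ≈ x ^ t
  ^-congʳ e = ^-cong ≈-refl e

  ^-0 : ∀ {x} → 0# < x → x ^ 0# ≈ 1#
  ^-0 {x} p = *-cancelˡ-≈ p (begin
    x * x ^ 0#        ≈⟨ *-comm _ _ ⟩
    x ^ 0# * x        ≈⟨ *-congˡ (^-1 p) ⟨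
    x ^ 0# * x ^ 1#   ≈⟨ ^-+ 0# 1# p ⟨
    x ^ (0# + 1#)     ≈⟨ ^-congʳ (+-identityˡ 1#) ⟩
    x ^ 1#            ≈⟨ ^-1 p ⟩
    x                 ≈⟨ *-identityʳ x ⟨
    x * 1#            ∎)

  1^ : ∀ s → 1# ^ s ≈ 1#
  1^ s = *-cancelˡ-≈ (^-pos s 0<1) (begin
    1# ^ s * 1# ^ s   ≈⟨ *-^ s 0<1 0<1 ⟨
    (1# * 1#) ^ s     ≈⟨ ^-congˡ (*-identityˡ 1#) ⟩
    1# ^ s            ≈⟨ *-identityʳ _ ⟨
    1# ^ s * 1#       ∎)

  ^-⁻¹ : ∀ {x} s → 0# < x → x ^ s * (x ⁻¹) ^ s ≈ 1#
  ^-⁻¹ {x} s p = begin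
    x ^ s * (x ⁻¹) ^ s   ≈⟨ *-^ s p (⁻¹-pos p) ⟨
    (x * x ⁻¹) ^ s       ≈⟨ ^-congˡ (*-⁻¹ p) ⟩
    1# ^ s               ≈⟨ 1^ s ⟩
    1#                   ∎

  ^-neg : ∀ {x} s → 0# < x → x ^ (- s) * x ^ s ≈ 1#
  ^-neg {x} s p = begin
    x ^ (- s) * x ^ s   ≈⟨ ^-+ (- s) s p ⟨
    x ^ (- s + s)       ≈⟨ ^-congʳ (-‿inverseˡ s) ⟩
    x ^ 0#              ≈⟨ ^-0 p ⟩
    1#                  ∎

  ^-root : ∀ {x s t} → 0# < x → s * t ≈ 1# → (x ^ s) ^ t ≈ x
  ^-root {x} {s} {t} p e = begin
    (x ^ s) ^ t   ≈⟨ ^-* s t p ⟨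
    x ^ (s * t)   ≈⟨ ^-congʳ e ⟩
    x ^ 1#        ≈⟨ ^-1 p ⟩
    x             ∎

  ^-pred : ∀ {x} s → 0# < x → x ^ s ≈ x ^ (s - 1#) * x
  ^-pred {x} s p = begin
    x ^ s                   ≈⟨ ^-congʳ (solve 1 (λ s → s := (s :- :1) :+ :1) ≈-refl s) ⟩
    x ^ ((s - 1#) + 1#)     ≈⟨ ^-+ (s - 1#) 1# p ⟩
    x ^ (s - 1#) * x ^ 1#   ≈⟨ *-congˡ (^-1 p) ⟩
    x ^ (s - 1#) * x        ∎

  -- Monotonicity in the base reduces to monotonicity in the exponent: y = x r with r ≥ 1, and r^s ≥
  -- r^0 = 1.
  ^-monoˡ-pos : ∀ {x y s} → 0# ≤ s → 0# < x → x ≤ y → x ^ s ≤ y ^ s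
  ^-monoˡ-pos {x} {y} {s} 0≤s 0<x x≤y = ≤-trans (≤-reflexive (≈-sym (*-identityʳ (x ^ s))))
    (≤-trans (*-monoˡ-≤ (<⇒≤ (^-pos s 0<x)) 1≤r^s)
      (≤-reflexive (≈-trans (≈-sym (*-^ s 0<x 0<r)) (^-congˡ (quotient y 0<x)))))
    where
    r : ℝ
    r = y * x ⁻¹
    1≤r : 1# ≤ r
    1≤r = *-cancelˡ-≤ 0<x (≤-trans (≤-reflexive (*-identityʳ x))
      (≤-trans x≤y (≤-reflexive (≈-sym (quotient y 0<x)))))
    0<r : 0# < r
    0<r = <-≤-trans 0<1 1≤r
    1≤r^s : 1# ≤ r ^ s
    1≤r^s = ≤-trans (≤-reflexive (≈-sym (^-0 0<r))) (^-monoʳ 1≤r 0≤s)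

  ^-nonneg : ∀ {x s} → 0# < s → 0# ≤ x → 0# ≤ x ^ s
  ^-nonneg {x} {s} 0<s 0≤x with 0≤⇒≈0⊎> 0≤x
  ... | inj₁ x≈0 = ≤-reflexive (≈-sym (≈-trans (^-congˡ x≈0) (0^ 0<s)))
  ... | inj₂ 0<x = <⇒≤ (^-pos s 0<x)

  ^-monoˡ : ∀ {x y s} → 0# < s → 0# ≤ x → x ≤ y → x ^ s ≤ y ^ s
  ^-monoˡ {x} {y} {s} 0<s 0≤x x≤y with 0≤⇒≈0⊎> 0≤x
  ... | inj₁ x≈0 = ≤-trans (≤-reflexive (≈-trans (^-congˡ x≈0) (0^ 0<s))) (^-nonneg 0<s (≤-trans 0≤x x≤y))
  ... | inj₂ 0<x = ^-monoˡ-pos (<⇒≤ 0<s) 0<x x≤y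

  -- The difference of the two sides is the square of x^s - x^t. All later convexity facts descend
  -- from this square.
  ^-midpoint : ∀ {x} s t → 0# < x → 2# * x ^ (s + t) ≤ x ^ (s + s) + x ^ (t + t)
  ^-midpoint {x} s t p = ≤-by (0≤x*x (x ^ s - x ^ t)) (begin
    (x ^ (s + s) + x ^ (t + t)) - 2# * x ^ (s + t)
      ≈⟨ +-cong (+-cong (^-+ s s p) (^-+ t t p)) (-‿cong (*-congˡ (^-+ s t p))) ⟩
    (x ^ s * x ^ s + x ^ t * x ^ t) - 2# * (x ^ s * x ^ t)
      ≈⟨ solve 2 (λ a b → (a :* a :+ b :* b) :- (:1 :+ :1) :* (a :* b) := (a :- b) :* (a :- b) :- :0)
           ≈-refl (x ^ s) (x ^ t) ⟩
    (x ^ s - x ^ t) * (x ^ s - x ^ t) - 0#   ∎)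

  -- Midpoint convexity of θ ↦ x ^ θ bounds the excess over the chord at θ by
  -- half the excess at 2θ or 2θ - 1, so the supremum of the excess is ≤ 0.
  weighted-AM-GM : ∀ {x θ} → 0# < x → 0# ≤ θ → θ ≤ 1# → x ^ θ ≤ θ * x + (1# - θ)
  weighted-AM-GM {x} {θ} 0<x 0≤θ θ≤1 = ≤-by
    (sup-halving I excess (x + 1# , bounded) halve (0≤θ , θ≤1))
    (solve 2 (λ y l → l :- y := :0 :- (y :- l)) ≈-refl _ _)
    where
    chord excess : ℝ → ℝ
    chord s = s * x + (1# - s)
    excess s = x ^ s - chord s

    I : Pred ℝ 0ℓ
    I s = 0# ≤ s × s ≤ 1#

    ^-bounded : ∀ {s} → I s → x ^ s ≤ x + 1#
    ^-bounded {s} (0≤s , s≤1) with total 1# x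
    ... | inj₁ 1≤x = ≤-by₂ (^-monoʳ 1≤x s≤1) 0≤1
          (≈-trans (solve 2 (λ x y → (x :+ :1) :- y := (x :- y) :+ (:1 :- :0)) ≈-refl x (x ^ s))
                   (+-congʳ (+-congʳ (≈-sym (^-1 0<x)))))
    ... | inj₂ x≤1 = ≤-by₂ (^-monoˡ-pos 0≤s 0<x x≤1) (<⇒≤ 0<x)
          (≈-trans (solve 2 (λ x y → (x :+ :1) :- y := (:1 :- y) :+ (x :- :0)) ≈-refl x (x ^ s))
                   (+-congʳ (+-congʳ (≈-sym (1^ s)))))

    bounded : ∀ {s} → I s → excess s ≤ x + 1#
    bounded {s} (0≤s , s≤1) = ≤-by₃ (^-bounded (0≤s , s≤1)) (*-nonneg 0≤s (<⇒≤ 0<x)) s≤1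
      (solve 3 (λ x s y → (x :+ :1) :- (y :- (s :* x :+ (:1 :- s)))
                        := ((x :+ :1) :- y) :+ (s :* x :- :0) :+ (:1 :- s)) ≈-refl x s (x ^ s))

    halve : ∀ t → (∀ {s} → I s → excess s ≤ t) → ∀ {s} → I s → excess s ≤ ½ * t
    halve t h {s} (0≤s , s≤1) = *-cancelˡ-≤ 0<2 (≤-trans (twice (total s ½)) (≤-reflexive (begin
      t             ≈⟨ ½+½ t ⟨
      ½ * t + ½ * t ≈⟨ solve 1 (λ x → x :+ x := (:1 :+ :1) :* x) ≈-refl (½ * t) ⟩
      2# * (½ * t)  ∎)))
      where
      ½+½≈1 : ½ + ½ ≈ 1#
      ½+½≈1 = ≈-trans (≈-sym (+-cong (*-identityʳ ½) (*-identityʳ ½))) (½+½ 1#)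

      twice : s ≤ ½ ⊎ ½ ≤ s → 2# * excess s ≤ t
      -- The chord agrees with the power at the exponents 0 and 1. As `s` is the midpoint of 0 and
      -- 2s, or of 1 and 2s - 1, only the excess at the other end remains.
      twice (inj₁ s≤½) = ≤-by₂ (^-midpoint 0# s 0<x)
          (h {s + s} (+-nonneg 0≤s 0≤s , ≤-trans (+-mono-≤ s≤½ s≤½) (≤-reflexive ½+½≈1))) (begin
        t - 2# * excess s ≈⟨ solve 5 (λ x s y z t → t :- (:1 :+ :1) :* (y :- (s :* x :+ (:1 :- s)))
           := ((:1 :+ z) :- (:1 :+ :1) :* y) :+ (t :- (z :- ((s :+ s) :* x :+ (:1 :- (s :+ s))))))
               ≈-refl x s (x ^ s) (x ^ (s + s)) t ⟩
        ((1# + x ^ (s + s)) - 2# * x ^ s) + (t - excess (s + s))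
          ≈⟨ +-congʳ (+-cong (+-congʳ (≈-trans (^-congʳ (+-identityˡ 0#)) (^-0 0<x)))
              (-‿cong (*-congˡ (^-congʳ (+-identityˡ s))))) ⟨
        ((x ^ (0# + 0#) + x ^ (s + s)) - 2# * x ^ (0# + s)) + (t - excess (s + s)) ∎)
      twice (inj₂ ½≤s) = ≤-by₂ (^-midpoint ½ (s - ½) 0<x) (h {w} (0≤w , w≤1)) (begin
        t - 2# * excess s ≈⟨ solve 5 (λ x s y z t → t :- (:1 :+ :1) :* (y :- (s :* x :+ (:1 :- s)))
           := ((x :+ z) :- (:1 :+ :1) :* y) :+
               (t :- (z :- ((s :+ s :- :1) :* x :+ (:1 :- (s :+ s :- :1)))))) ≈-refl x s (x ^ s) (x ^ w) t ⟩
        ((x + x ^ w) - 2# * x ^ s) + (t - excess w)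
          ≈⟨ +-congʳ (+-cong (+-cong (≈-trans (^-congʳ ½+½≈1) (^-1 0<x)) (^-congʳ w-eq))
              (-‿cong (*-congˡ (^-congʳ (solve 2 (λ h s → h :+ (s :- h) := s) ≈-refl ½ s))))) ⟨
        ((x ^ (½ + ½) + x ^ ((s - ½) + (s - ½))) - 2# * x ^ (½ + (s - ½))) + (t - excess w) ∎)
        where
        w : ℝ
        w = s + s - 1#
        w-eq : (s - ½) + (s - ½) ≈ w
        w-eq = ≈-trans (solve 2 (λ h s → (s :- h) :+ (s :- h) := s :+ s :- (h :+ h))
            ≈-refl ½ s) (+-congˡ (-‿cong ½+½≈1))
        0≤w : 0# ≤ w
        0≤w = ≤-trans (+-nonneg (≤⇒0≤- ½≤s) (≤⇒0≤- ½≤s)) (≤-reflexive w-eq)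
        w≤1 : w ≤ 1#
        w≤1 = ≤-by₂ s≤1 s≤1 (solve 1 (λ s → :1 :- (s :+ s :- :1) := (:1 :- s) :+ (:1 :- s)) ≈-refl s)

-- Tangent, trapezoid and edge inequalities for the p-th power

module PowerInequalities (em : ExcludedMiddle 0ℓ) (R : CompleteOrderedField) (Pow : RealPower R) where
  open CompleteOrderedField R hiding (refl; sym; trans)
  open OrderedField R
  open ClassicalOrder em R
  open RealPower Pow
  open Powers em R Pow
  open SetoidReasoning setoid

  module Exponent (p : ℝ) (1<p : 1# < p) where

    p-1 : ℝ
    p-1 = p - 1#

    0<p-1 : 0# < p-1
    0<p-1 = <⇒0<- 1<p

    0≤p-1 : 0# ≤ p-1
    0≤p-1 = <⇒≤ 0<p-1

    0<p : 0# < p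
    0<p = ≤-<-trans 0≤1 1<p

    0≤p : 0# ≤ p
    0≤p = <⇒≤ 0<p

    -- Weighted AM-GM for the base r^p with weight 1/p, multiplied by p.
    bernoulli : ∀ {r} → 0# < r → p * r ≤ r ^ p + p-1
    bernoulli {r} 0<r = ≤-trans (*-monoˡ-≤ 0≤p (≤-trans (≤-reflexive (≈-sym (^-root 0<r (*-⁻¹ 0<p))))
        (weighted-AM-GM (^-pos p 0<r) (<⇒≤ 0<p⁻¹) p⁻¹≤1))) (≤-reflexive (begin
      p * (p ⁻¹ * r ^ p + (1# - p ⁻¹))
        ≈⟨ solve 3 (λ p i y → p :* (i :* y :+ (:1 :- i)) := (p :* i) :* y :+ (p :- p :* i))
            ≈-refl p (p ⁻¹) (r ^ p) ⟩
      (p * p ⁻¹) * r ^ p + (p - p * p ⁻¹)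
        ≈⟨ +-cong (*-congʳ (*-⁻¹ 0<p)) (+-congˡ (-‿cong (*-⁻¹ 0<p))) ⟩
      1# * r ^ p + (p - 1#)
        ≈⟨ +-congʳ (*-identityˡ _) ⟩
      r ^ p + p-1   ∎))
      where
      0<p⁻¹ : 0# < p ⁻¹
      0<p⁻¹ = ⁻¹-pos 0<p
      p⁻¹≤1 : p ⁻¹ ≤ 1#
      p⁻¹≤1 = *-cancelˡ-≤ 0<p (≤-trans (≤-reflexive (*-⁻¹ 0<p))
        (≤-trans (<⇒≤ 1<p) (≤-reflexive (≈-sym (*-identityʳ p)))))

    -- Bernoulli at r = c/a, scaled by a^p; c = 0 is apart because r must be positive. Read
    -- differently, the graph of t^p lies above its tangent at `a`, evaluated at `c`.
    young : ∀ {a c} → 0# < a → 0# ≤ c → p * (a ^ p-1 * c) ≤ c ^ p + p-1 * a ^ p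
    young {a} {c} 0<a 0≤c with 0≤⇒≈0⊎> 0≤c
    ... | inj₁ c≈0 = ≤-by₂ (^-nonneg 0<p 0≤c) (*-nonneg 0≤p-1 (<⇒≤ (^-pos p 0<a))) (begin
      (c ^ p + p-1 * a ^ p) - p * (a ^ p-1 * c)
        ≈⟨ +-congˡ (-‿cong (*-congˡ (*-congˡ c≈0))) ⟩
      (c ^ p + p-1 * a ^ p) - p * (a ^ p-1 * 0#)
        ≈⟨ solve 4 (λ p t c a → (c :+ a) :- p :* (t :* :0) := (c :- :0) :+ (a :- :0))
            ≈-refl p (a ^ p-1) (c ^ p) (p-1 * a ^ p) ⟩
      (c ^ p - 0#) + (p-1 * a ^ p - 0#) ∎)
    ... | inj₂ 0<c = ≤-by (*-monoˡ-≤ (<⇒≤ (^-pos p 0<a)) (bernoulli 0<r)) (begin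
      (c ^ p + p-1 * a ^ p) - p * (a ^ p-1 * c)
        ≈⟨ +-cong (+-congʳ (≈-trans (^-congˡ (≈-sym ar≈c)) (*-^ p 0<a 0<r)))
            (-‿cong (*-congˡ (*-congˡ (≈-sym ar≈c)))) ⟩
      (a ^ p * r ^ p + p-1 * a ^ p) - p * (a ^ p-1 * (a * r))
        ≈⟨ +-congˡ (-‿cong (solve 4 (λ p t a r → p :* (t :* (a :* r)) := (t :* a) :* (p :* r))
            ≈-refl p (a ^ p-1) a r)) ⟩
      (a ^ p * r ^ p + p-1 * a ^ p) - (a ^ p-1 * a) * (p * r)
        ≈⟨ +-congˡ (-‿cong (*-congʳ (^-pred p 0<a))) ⟨
      (a ^ p * r ^ p + p-1 * a ^ p) - a ^ p * (p * r)
        ≈⟨ solve 4 (λ p a r q → (a :* r :+ q :* a) :- p := a :* (r :+ q) :- p)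
            ≈-refl (a ^ p * (p * r)) (a ^ p) (r ^ p) p-1 ⟩
      a ^ p * (r ^ p + p-1) - a ^ p * (p * r) ∎)
      where
      r : ℝ
      r = c * a ⁻¹
      0<r : 0# < r
      0<r = *-pos 0<c (⁻¹-pos 0<a)
      ar≈c : a * r ≈ c
      ar≈c = quotient c 0<a

    -- The tangent at the midpoint lies below the power at both ends; adding the two inequalities
    -- cancels the slope.
    ^-midpoint-convex : ∀ {b h} → 0# ≤ b → 0# < h →
      2# * (b + h) ^ p ≤ b ^ p + ((b + h) + h) ^ p
    ^-midpoint-convex {b} {h} 0≤b 0<h = ≤-by₂ (young 0<e 0≤b) (young 0<e (<⇒≤ (+-pos 0<e 0<h))) (begin
      (b ^ p + a ^ p) - 2# * e ^ p
        ≈⟨ solve 4 (λ p u v w → (u :+ v) :- (:1 :+ :1) :* w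
           := ((u :+ (p :- :1) :* w) :+ (v :+ (p :- :1) :* w)) :- (p :* w :+ p :* w))
               ≈-refl p (b ^ p) (a ^ p) (e ^ p) ⟩
      ((b ^ p + p-1 * e ^ p) + (a ^ p + p-1 * e ^ p)) - (p * e ^ p + p * e ^ p)
        ≈⟨ +-congˡ (-‿cong (+-cong (*-congˡ (^-pred p 0<e)) (*-congˡ (^-pred p 0<e)))) ⟩
      ((b ^ p + p-1 * e ^ p) + (a ^ p + p-1 * e ^ p)) - (p * (e ^ p-1 * e) + p * (e ^ p-1 * e))
        ≈⟨ solve 6 (λ u v p t b h → (u :+ v) :- (p :* (t :* (b :+ h)) :+ p :* (t :* (b :+ h)))
            := (u :- p :* (t :* b)) :+ (v :- p :* (t :* (b :+ h :+ h)))) ≈-refl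
            (b ^ p + p-1 * e ^ p) (a ^ p + p-1 * e ^ p) p (e ^ p-1) b h ⟩
      ((b ^ p + p-1 * e ^ p) - p * (e ^ p-1 * b)) + ((a ^ p + p-1 * e ^ p) - p * (e ^ p-1 * a)) ∎)
      where
      e a : ℝ
      e = b + h
      a = e + h
      0<e : 0# < e
      0<e = <-respʳ (+-comm h b) (+-pos-nonneg 0<h 0≤b)

    -- The trapezoid rule overestimates the integral of the convex function t ^ p;
    -- subdividing at the midpoint makes the discrepancy `gap` grow, while over
    -- short intervals it is at most quadratic in the length.
    module Trapezoid (c : ℝ) (0<c : 0# < c) where

      -- The integral of p c t^(p-1) - c^p - (p-1) t^p over [b, b + δ], less p - 1 times the error
      -- of the trapezoid rule for t^p; heuristically both contributions are nonpositive.
      gap : ℝ → ℝ → ℝ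
      gap b δ = c * ((b + δ) ^ p - b ^ p) - δ * (p-1 * (½ * ((b + δ) ^ p + b ^ p)) + c ^ p)

      -- The terms with `c` are additive over adjacent intervals; what remains is h (p-1)/2 times
      -- the midpoint convexity inequality.
      gap-subdivide : ∀ {b h} → 0# ≤ b → 0# < h → gap b (h + h) ≤ gap b h + gap (b + h) h
      gap-subdivide {b} {h} 0≤b 0<h = ≤-by
        (*-monoˡ-≤ (*-nonneg (*-nonneg (<⇒≤ 0<h) 0≤p-1) 0≤½) (^-midpoint-convex 0≤b 0<h)) (begin
        (gap b h + gap (b + h) h) - gap b (h + h)
          ≈⟨ +-congˡ (-‿cong (+-cong (*-congˡ (+-congʳ a-eq))
              (-‿cong (*-congˡ (+-congʳ (*-congˡ (*-congˡ (+-congʳ a-eq)))))))) ⟩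
        _ ≈⟨ solve 8 (λ c h q d B E A C →
              ((c :* (E :- B) :- h :* (q :* (d :* (E :+ B)) :+ C)) :+
                  (c :* (A :- E) :- h :* (q :* (d :* (A :+ E)) :+ C)))
                :- (c :* (A :- B) :- (h :+ h) :* (q :* (d :* (A :+ B)) :+ C))
              := h :* q :* d :* (B :+ A) :- h :* q :* d :* ((:1 :+ :1) :* E)) ≈-refl
              c h p-1 ½ (b ^ p) ((b + h) ^ p) (((b + h) + h) ^ p) (c ^ p) ⟩
        _ ∎)
        where
        a-eq : (b + (h + h)) ^ p ≈ ((b + h) + h) ^ p
        a-eq = ^-congˡ (≈-sym (+-assoc b h h))

      -- Tangent and Young inequalities at the right end a = b + δ leave (p-1)/2 · δ (a^p - b^p),
      -- and the tangent once more yields a second factor δ. Passing from `a` to `A` makes the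
      -- constant the same for all intervals below `A`.
      gap-quadratic : ∀ {b δ A} → 0# ≤ b → 0# < δ → b + δ ≤ A →
        gap b δ ≤ (p-1 * ½ * (p * A ^ p-1)) * (δ * δ)
      gap-quadratic {b} {δ} {A} 0≤b 0<δ a≤A = ≤-by₃
        chord
        (*-monoˡ-≤ (*-nonneg (*-nonneg 0≤p-1 0≤½) (<⇒≤ 0<δ)) tangent)
        (*-monoˡ-≤ (*-nonneg (*-nonneg 0≤p-1 0≤½) (*-nonneg 0≤p (<⇒≤ (*-pos 0<δ 0<δ))))
            (^-monoˡ 0<p-1 (<⇒≤ 0<a) a≤A))
        (begin
          _ ≈⟨ solve 10 (λ c q d u v C t p A τ →
                 (q :* d :* (p :* A)) :* (t :* t) :- (c :* (u :- v) :- t :* (q :* (d :* (u :+ v)) :+ C))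
                 := ((t :* (C :+ q :* u) :- c :* (u :- v))
                    :+ (q :* d :* t :* (p :* (τ :* t)) :- q :* d :* t :* (u :- v))
                    :+ (q :* d :* (p :* (t :* t)) :* A :- q :* d :* (p :* (t :* t)) :* τ))
                    :+ t :* q :* ((d :* u :+ d :* u) :- u)) ≈-refl
                 c p-1 ½ (a ^ p) (b ^ p) (c ^ p) δ p (A ^ p-1) τ ⟩
          S + δ * p-1 * ((½ * a ^ p + ½ * a ^ p) - a ^ p)
            ≈⟨ +-congˡ (*-congˡ (+-congʳ (½+½ _))) ⟩
          S + δ * p-1 * (a ^ p - a ^ p)
            ≈⟨ solve 3 (λ s x y → s :+ x :* (y :- y) := s) ≈-refl S _ _ ⟩
          S ∎)
        where
        a τ S : ℝ
        a = b + δ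
        τ = a ^ p-1
        S = (δ * (c ^ p + p-1 * a ^ p) - c * (a ^ p - b ^ p))
          + (p-1 * ½ * δ * (p * (τ * δ)) - p-1 * ½ * δ * (a ^ p - b ^ p))
          + (p-1 * ½ * (p * (δ * δ)) * A ^ p-1 - p-1 * ½ * (p * (δ * δ)) * τ)
        0<a : 0# < a
        0<a = <-respʳ (+-comm δ b) (+-pos-nonneg 0<δ 0≤b)
        tangent : a ^ p - b ^ p ≤ p * (τ * δ)
        tangent = ≤-by (young 0<a 0≤b) (begin
          p * (τ * δ) - (a ^ p - b ^ p)
            ≈⟨ solve 6 (λ p t b d u v → p :* (t :* d) :- (u :- v)
                := (v :+ (p :- :1) :* u) :- p :* (t :* b) :- (p :* u :- p :* (t :* (b :+ d))))
                    ≈-refl p τ b δ (a ^ p) (b ^ p) ⟩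
          ((b ^ p + p-1 * a ^ p) - p * (τ * b)) - (p * a ^ p - p * (τ * a))
            ≈⟨ +-congˡ (-‿cong (+-congʳ (*-congˡ (^-pred p 0<a)))) ⟩
          ((b ^ p + p-1 * a ^ p) - p * (τ * b)) - (p * (τ * a) - p * (τ * a))
            ≈⟨ solve 2 (λ x y → x :- (y :- y) := x) ≈-refl _ _ ⟩
          (b ^ p + p-1 * a ^ p) - p * (τ * b) ∎)
        chord : c * (a ^ p - b ^ p) ≤ δ * (c ^ p + p-1 * a ^ p)
        chord = ≤-by₂ (*-monoˡ-≤ (<⇒≤ 0<c) tangent) (*-monoˡ-≤ (<⇒≤ 0<δ) (young 0<a (<⇒≤ 0<c)))
          (solve 6 (λ c d p t u k → d :* u :- c :* k
              := (c :* (p :* (t :* d)) :- c :* k) :+ (d :* u :- d :* (p :* (t :* c)))) ≈-refl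
            c δ p τ (c ^ p + p-1 * a ^ p) (a ^ p - b ^ p))

      -- Division by δ² makes bisection a halving: each of the two halves carries a quarter of δ².
      -- The quadratic estimate is what bounds this ratio on arbitrarily short intervals.
      gap≤0 : ∀ {b δ} → 0# ≤ b → 0# < δ → gap b δ ≤ 0#
      gap≤0 {b₀} {δ₀} 0≤b₀ 0<δ₀ = unscale 0<δ₀
          (sup-halving Inside ratio (K , bounded) halve (0≤b₀ , 0<δ₀ , ≤-refl))
        where
        A K : ℝ
        A = b₀ + δ₀
        K = p-1 * ½ * (p * A ^ p-1)

        Inside : Pred (ℝ × ℝ) 0ℓ
        Inside (b , δ) = 0# ≤ b × 0# < δ × b + δ ≤ A

        ratio : ℝ × ℝ → ℝ
        ratio (b , δ) = gap b δ * (δ * δ) ⁻¹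

        ratio-≤ : ∀ {b δ t} → 0# < δ → gap b δ ≤ t * (δ * δ) → ratio (b , δ) ≤ t
        ratio-≤ {b} {δ} {t} 0<δ h = *-cancelˡ-≤ (*-pos 0<δ 0<δ)
            (≤-trans (≤-reflexive (quotient _ (*-pos 0<δ 0<δ)))
          (≤-trans h (≤-reflexive (*-comm t (δ * δ)))))

        gap-≤ : ∀ {b δ t} → 0# < δ → ratio (b , δ) ≤ t → gap b δ ≤ (δ * δ) * t
        gap-≤ {b} {δ} {t} 0<δ h = ≤-trans (≤-reflexive (≈-sym (quotient _ (*-pos 0<δ 0<δ))))
          (*-monoˡ-≤ (<⇒≤ (*-pos 0<δ 0<δ)) h)

        unscale : ∀ {b δ} → 0# < δ → ratio (b , δ) ≤ 0# → gap b δ ≤ 0#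
        unscale 0<δ h = ≤-trans (gap-≤ 0<δ h) (≤-reflexive (zeroʳ _))

        bounded : ∀ {i} → Inside i → ratio i ≤ K
        bounded (0≤b , 0<δ , b+δ≤A) = ratio-≤ 0<δ (gap-quadratic 0≤b 0<δ b+δ≤A)

        gap-cong : ∀ {b δ δ′} → δ ≈ δ′ → gap b δ ≈ gap b δ′
        gap-cong e = +-cong (*-congˡ (+-congʳ (^-congˡ (+-congˡ e))))
          (-‿cong (*-cong e (+-congʳ (*-congˡ (*-congˡ (+-congʳ (^-congˡ (+-congˡ e))))))))

        halve : ∀ t → (∀ {j} → Inside j → ratio j ≤ t) → ∀ {i} → Inside i → ratio i ≤ ½ * t
        halve t h {b , δ} (0≤b , 0<δ , b+δ≤A) = ratio-≤ 0<δ (≤-trans (≤-reflexive (≈-sym (gap-cong (½+½ δ))))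
          (≤-trans (gap-subdivide 0≤b 0<η) (≤-trans (+-mono-≤
            (gap-≤ 0<η (h (0≤b , 0<η , ≤-trans (≤-by (<⇒≤ 0<η)
                (solve 2 (λ b η → (b :+ η :+ η) :- (b :+ η) := η :- :0) ≈-refl b η)) b+η+η≤A)))
            (gap-≤ 0<η (h (+-nonneg 0≤b (<⇒≤ 0<η) , 0<η , b+η+η≤A))))
            (≤-reflexive (begin
              (η * η) * t + (η * η) * t  ≈⟨ +-cong (*-congˡ (½+½ t)) (*-congˡ (½+½ t)) ⟨
              (η * η) * (½ * t + ½ * t) + (η * η) * (½ * t + ½ * t)
                ≈⟨ solve 2 (λ n x → n :* n :* (x :+ x) :+ n :* n :* (x :+ x)
                    := x :* ((n :+ n) :* (n :+ n))) ≈-refl η (½ * t) ⟩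
              ½ * t * ((η + η) * (η + η))  ≈⟨ *-congˡ (*-cong (½+½ δ) (½+½ δ)) ⟩
              ½ * t * (δ * δ) ∎)))))
          where
          η : ℝ
          η = ½ * δ
          0<η : 0# < η
          0<η = *-pos 0<½ 0<δ
          b+η+η≤A : b + η + η ≤ A
          b+η+η≤A = ≤-trans (≤-reflexive (≈-trans (+-assoc b η η) (+-congˡ (½+½ δ)))) b+δ≤A

    amghibech : ∀ {a b c} → 0# < c → 0# ≤ b → 0# < a - b →
      c * (a ^ p - b ^ p) ≤ (a - b) * (p-1 * (½ * (a ^ p + b ^ p)) + c ^ p)
    amghibech {a} {b} {c} 0<c 0≤b 0<δ = ≤-by (gap≤0 0≤b 0<δ) (begin
      (a - b) * (p-1 * (½ * (a ^ p + b ^ p)) + c ^ p) - c * (a ^ p - b ^ p)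
        ≈⟨ +-cong (*-congˡ (+-congʳ (*-congˡ (*-congˡ (+-congʳ a-eq))))) (-‿cong (*-congˡ (+-congʳ a-eq))) ⟨
      (a - b) * (p-1 * (½ * ((b + (a - b)) ^ p + b ^ p)) + c ^ p) - c * ((b + (a - b)) ^ p - b ^ p)
        ≈⟨ solve 2 (λ x y → x :- y := :0 :- (y :- x)) ≈-refl _ _ ⟩
      0# - gap b (a - b) ∎)
      where
      open Trapezoid c 0<c
      a-eq : (b + (a - b)) ^ p ≈ a ^ p
      a-eq = ^-congˡ (solve 2 (λ a b → b :+ (a :- b) := a) ≈-refl a b)

    -- `q` is the exponent conjugate to `p`, and r = q - 1.
    q r : ℝ
    q = p * p-1 ⁻¹
    r = p-1 ⁻¹

    0<r : 0# < r
    0<r = ⁻¹-pos 0<p-1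

    0<q : 0# < q
    0<q = *-pos 0<p 0<r

    p-1*r≈1 : p-1 * r ≈ 1#
    p-1*r≈1 = *-⁻¹ 0<p-1

    q≈1+r : q ≈ 1# + r
    q≈1+r = begin
      p * r             ≈⟨ solve 2 (λ p r → p :* r := (p :- :1) :* r :+ r) ≈-refl p r ⟩
      p-1 * r + r       ≈⟨ +-congʳ p-1*r≈1 ⟩
      1# + r            ∎

    -- The free parameter of `amghibech` is c = (u / d) ^ r * (a - b).
    edge-bound : ∀ {a b d u} → 0# ≤ d → 0# < u → 0# ≤ b → b ≤ a →
      d * (a ^ p - b ^ p) ≤ u * (a - b) ^ p + p-1 * (u ^ (- r) * d ^ q) * (½ * (a ^ p + b ^ p))
    edge-bound {a} {b} {d} {u} 0≤d 0<u 0≤b b≤a = by-cases (0≤⇒≈0⊎> 0≤d) (0≤⇒≈0⊎> 0≤δ)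
      where
      0≤δ : 0# ≤ a - b
      0≤δ = ≤⇒0≤- b≤a
      δ m V rhs : ℝ
      δ = a - b
      m = ½ * (a ^ p + b ^ p)
      V = u ^ (- r)
      rhs = u * δ ^ p + p-1 * (V * d ^ q) * m

      0≤rhs : 0# ≤ rhs
      0≤rhs = +-nonneg (*-nonneg (<⇒≤ 0<u) (^-nonneg 0<p 0≤δ))
        (*-nonneg (*-nonneg 0≤p-1 (*-nonneg (<⇒≤ (^-pos (- r) 0<u)) (^-nonneg 0<q 0≤d)))
          (*-nonneg 0≤½ (+-nonneg (^-nonneg 0<p (≤-trans 0≤b b≤a)) (^-nonneg 0<p 0≤b))))

      by-cases : d ≈ 0# ⊎ 0# < d → δ ≈ 0# ⊎ 0# < δ → d * (a ^ p - b ^ p) ≤ rhs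
      -- The parameter `c` must be positive and involves division by `d`, so d = 0 and a = b are
      -- treated apart; there the left side vanishes.
      by-cases (inj₁ d≈0) _ = ≤-trans (≤-reflexive (≈-trans (*-congʳ d≈0) (zeroˡ _))) 0≤rhs
      by-cases (inj₂ _) (inj₁ δ≈0) = ≤-trans (≤-reflexive (begin
          d * (a ^ p - b ^ p)   ≈⟨ *-congˡ (+-congʳ (^-congˡ a≈b)) ⟩
          d * (b ^ p - b ^ p)   ≈⟨ solve 2 (λ d b → d :* (b :- b) := :0) ≈-refl d (b ^ p) ⟩
          0#                    ∎)) 0≤rhs
        where
        a≈b : a ≈ b
        a≈b = ≈-trans (solve 2 (λ a b → a := a :- b :+ b) ≈-refl a b) (≈-trans (+-congʳ δ≈0) (+-identityˡ b))
      -- `amghibech` at c = w δ is multiplied by `Z`; the identities Z w = d and Z w^p = u turn it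
      -- into the claim times δ.
      by-cases (inj₂ 0<d) (inj₂ 0<δ) = *-cancelˡ-≤ 0<δ (≤-by
          (*-monoˡ-≤ (<⇒≤ 0<Z) (amghibech 0<c 0≤b 0<δ)) (begin
        δ * rhs - δ * (d * k)
          ≈⟨ solve 7 (λ δ u D q Z m dk → δ :* (u :* D :+ q :* Z :* m) :- δ :* dk
              := δ :* (q :* Z :* m :+ u :* D) :- δ :* dk) ≈-refl δ u (δ ^ p) p-1 Z m (d * k) ⟩
        δ * (p-1 * Z * m + u * δ ^ p) - δ * (d * k)
          ≈⟨ +-cong (*-congˡ (+-congˡ (*-congʳ (≈-sym Zw^p≈u)))) (-‿cong (*-congˡ (*-congʳ (≈-sym Zw≈d)))) ⟩
        δ * (p-1 * Z * m + Z * w ^ p * δ ^ p) - δ * (Z * w * k)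
          ≈⟨ solve 8 (λ δ q Z m W D w k → δ :* (q :* Z :* m :+ Z :* W :* D) :- δ :* (Z :* w :* k)
               := Z :* (δ :* (q :* m :+ W :* D)) :- Z :* (w :* δ :* k)) ≈-refl δ p-1 Z m (w ^ p) (δ ^ p) w k ⟩
        Z * (δ * (p-1 * m + w ^ p * δ ^ p)) - Z * (w * δ * k)
          ≈⟨ +-congʳ (*-congˡ (*-congˡ (+-congˡ (*-^ p 0<w 0<δ)))) ⟨
        Z * (δ * (p-1 * m + (w * δ) ^ p)) - Z * (w * δ * k) ∎))
        where
        v w Z k : ℝ
        v = u * d ⁻¹
        w = v ^ r
        Z = V * d ^ q
        k = a ^ p - b ^ p
        0<v : 0# < v
        0<v = *-pos 0<u (⁻¹-pos 0<d)
        0<w : 0# < w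
        0<w = ^-pos r 0<v
        0<c : 0# < w * δ
        0<c = *-pos 0<w 0<δ
        0<Z : 0# < Z
        0<Z = *-pos (^-pos (- r) 0<u) (^-pos q 0<d)
        Zw≈d : Z * w ≈ d
        Zw≈d = begin
          V * d ^ q * w                                ≈⟨ *-cong (*-congˡ d^q) (*-^ r 0<u (⁻¹-pos 0<d)) ⟩
          V * (d * d ^ r) * (u ^ r * (d ⁻¹) ^ r)       ≈⟨ solve 5
              (λ V d D U E → V :* (d :* D) :* (U :* E) := (V :* U) :* (D :* E) :* d)
                  ≈-refl V d (d ^ r) (u ^ r) ((d ⁻¹) ^ r) ⟩
          (V * u ^ r) * (d ^ r * (d ⁻¹) ^ r) * d       ≈⟨ *-congʳ (*-cong (^-neg r 0<u) (^-⁻¹ r 0<d)) ⟩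
          1# * 1# * d                                  ≈⟨ solve 1 (λ d → :1 :* :1 :* d := d) ≈-refl d ⟩
          d                                            ∎
          where
          d^q : d ^ q ≈ d * d ^ r
          d^q = begin
            d ^ q            ≈⟨ ^-congʳ q≈1+r ⟩
            d ^ (1# + r)     ≈⟨ ^-+ 1# r 0<d ⟩
            d ^ 1# * d ^ r   ≈⟨ *-congʳ (^-1 0<d) ⟩
            d * d ^ r        ∎
        Zw^p≈u : Z * w ^ p ≈ u
        Zw^p≈u = begin
          Z * w ^ p           ≈⟨ *-congˡ (^-pred p 0<w) ⟩
          Z * (w ^ p-1 * w)   ≈⟨ *-congˡ (*-congʳ (^-root 0<v (≈-trans (*-comm r p-1) p-1*r≈1))) ⟩
          Z * (v * w)         ≈⟨ solve 3 (λ Z v w → Z :* (v :* w) := (Z :* w) :* v) ≈-refl Z v w ⟩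
          Z * w * v           ≈⟨ *-congʳ Zw≈d ⟩
          d * (u * d ⁻¹)      ≈⟨ quotient u 0<d ⟩
          u                   ∎

-- Finite sums and bounds on partial sums

module Sums (em : ExcludedMiddle 0ℓ) (R : CompleteOrderedField) (Pow : RealPower R) where
  open Analysis em R Pow hiding (refl; sym; trans)
  open OrderedField R
  open ClassicalOrder em R
  open SetoidReasoning setoid

  private
    variable
      I J X : Set

  sum-cong : {u v : I → ℝ} → (∀ i → u i ≈ v i) → ∀ xs → sumOver u xs ≈ sumOver v xs
  sum-cong e []       = ≈-refl
  sum-cong e (x ∷ xs) = +-cong (e x) (sum-cong e xs)

  sum-mono : {u v : I → ℝ} {P : Pred I 0ℓ} → (∀ {i} → P i → u i ≤ v i) → ∀ {xs} → All P xs →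
    sumOver u xs ≤ sumOver v xs
  sum-mono h []         = ≤-refl
  sum-mono h (px ∷ pxs) = +-mono-≤ (h px) (sum-mono h pxs)

  sum-mono-∀ : {u v : I → ℝ} → (∀ i → u i ≤ v i) → ∀ xs → sumOver u xs ≤ sumOver v xs
  sum-mono-∀ h []       = ≤-refl
  sum-mono-∀ h (x ∷ xs) = +-mono-≤ (h x) (sum-mono-∀ h xs)

  sum-+ : (u v : I → ℝ) → ∀ xs → sumOver (λ i → u i + v i) xs ≈ sumOver u xs + sumOver v xs
  sum-+ u v []       = ≈-sym (+-identityˡ 0#)
  sum-+ u v (x ∷ xs) = ≈-trans (+-congˡ (sum-+ u v xs))
    (solve 4 (λ a b s t → (a :+ b) :+ (s :+ t) := (a :+ s) :+ (b :+ t)) ≈-refl (u x) (v x) _ _)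

  sum-* : (c : ℝ) (u : I → ℝ) → ∀ xs → sumOver (λ i → c * u i) xs ≈ c * sumOver u xs
  sum-* c u []       = ≈-sym (zeroʳ c)
  sum-* c u (x ∷ xs) = ≈-trans (+-congˡ (sum-* c u xs)) (≈-sym (distribˡ c (u x) _))

  sum-++ : (u : I → ℝ) → ∀ xs ys → sumOver u (xs ++ ys) ≈ sumOver u xs + sumOver u ys
  sum-++ u []       ys = ≈-sym (+-identityˡ _)
  sum-++ u (x ∷ xs) ys = ≈-trans (+-congˡ (sum-++ u xs ys)) (≈-sym (+-assoc (u x) _ _))

  sum-map : (u : J → ℝ) (f : I → J) → ∀ xs → sumOver u (map f xs) ≡ sumOver (u ∘ f) xs
  sum-map u f []       = ≡.refl
  sum-map u f (x ∷ xs) = ≡.cong (u (f x) +_) (sum-map u f xs)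

  Nonneg : (I → ℝ) → Set
  Nonneg u = ∀ i → 0# ≤ u i

  sum-nonneg : {u : I → ℝ} → Nonneg u → ∀ xs → 0# ≤ sumOver u xs
  sum-nonneg h []       = ≤-refl
  sum-nonneg h (x ∷ xs) = +-nonneg (h x) (sum-nonneg h xs)

  sum-nonpos : {u : I → ℝ} → (∀ i → u i ≤ 0#) → ∀ xs → sumOver u xs ≤ 0#
  sum-nonpos h []       = ≤-refl
  sum-nonpos h (x ∷ xs) = ≤-trans (+-mono-≤ (h x) (sum-nonpos h xs)) (≤-reflexive (+-identityˡ 0#))

  -- Each element of `xs` is cut out of `ys` at one occurrence; uniqueness keeps the rest of `xs`
  -- inside what is left.
  sum-⊆ : {u : I → ℝ} → Nonneg u → ∀ {xs ys} → Unique xs → xs ⊆ ys → sumOver u xs ≤ sumOver u ys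
  sum-⊆ h {[]}     {ys} _  _  = sum-nonneg h ys
  sum-⊆ {u = u} h {x ∷ xs} {ys} (x∉xs ∷ xs!) sub with ∈-∃++ (sub (here ≡.refl))
  ... | as , bs , ≡.refl = ≤-trans (+-mono-≤ ≤-refl (sum-⊆ h xs! xs⊆))
      (≤-reflexive (begin
        u x + sumOver u (as ++ bs)              ≈⟨ +-congˡ (sum-++ u as bs) ⟩
        u x + (sumOver u as + sumOver u bs)     ≈⟨ solve 3 (λ a b c → a :+ (b :+ c)
            := b :+ (a :+ c)) ≈-refl (u x) _ _ ⟩
        sumOver u as + sumOver u (x ∷ bs)       ≈⟨ sum-++ u as (x ∷ bs) ⟨
        sumOver u (as ++ x ∷ bs)                ∎))
    where
    xs⊆ : xs ⊆ as ++ bs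
    xs⊆ z∈xs with ∈-++⁻ as (sub (there z∈xs))
    ... | inj₁ z∈as          = ∈-++⁺ˡ z∈as
    ... | inj₂ (here ≡.refl) = ⊥-elim (All.lookup x∉xs z∈xs ≡.refl)
    ... | inj₂ (there z∈bs)  = ∈-++⁺ʳ as z∈bs

  _≟_ : DecidableEquality I
  _ ≟ _ = em

  union : List I → List I → List I
  union xs ys = deduplicate _≟_ (xs ++ ys)

  union-! : (xs ys : List I) → Unique (union xs ys)
  union-! xs ys = deduplicate-! _≟_ (xs ++ ys)

  ⊆-unionˡ : (xs ys : List I) → xs ⊆ union xs ys
  ⊆-unionˡ xs ys p = ∈-deduplicate⁺ _≟_ (∈-++⁺ˡ p)

  ⊆-unionʳ : (xs ys : List I) → ys ⊆ union xs ys
  ⊆-unionʳ xs ys p = ∈-deduplicate⁺ _≟_ (∈-++⁺ʳ xs p)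

  -- A real-valued stand-in for `∑ U u ≤± [ t ]`, which keeps the estimates out of the extended
  -- reals.
  PartialSums≤ : (I → ℝ) → ℝ → Set
  PartialSums≤ u t = ∀ xs → Unique xs → sumOver u xs ≤ t

  partialSums-mono : {u v : I → ℝ} {t : ℝ} → (∀ i → u i ≤ v i) → PartialSums≤ v t → PartialSums≤ u t
  partialSums-mono h b xs xs! = ≤-trans (sum-mono-∀ h xs) (b xs xs!)

  partialSums-+ : {u v : I → ℝ} {s t : ℝ} → PartialSums≤ u s → PartialSums≤ v t →
    PartialSums≤ (λ i → u i + v i) (s + t)
  partialSums-+ {u = u} {v} bu bv xs xs! =
    ≤-trans (≤-reflexive (sum-+ u v xs)) (+-mono-≤ (bu xs xs!) (bv xs xs!))

  partialSums-* : {c : ℝ} {u : I → ℝ} {t : ℝ} → 0# ≤ c → PartialSums≤ u t →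
    PartialSums≤ (λ i → c * u i) (c * t)
  partialSums-* {c = c} {u} 0≤c b xs xs! = ≤-trans (≤-reflexive (sum-* c u xs)) (*-monoˡ-≤ 0≤c (b xs xs!))

  partialSums-term : {u : I → ℝ} {t : ℝ} → PartialSums≤ u t → ∀ i → u i ≤ t
  partialSums-term {u = u} b i = ≤-trans (≤-reflexive (≈-sym (+-identityʳ (u i)))) (b (i ∷ []) ([] ∷ []))

  -- Both sums only grow when taken over the union of the two lists, where they merge into one
  -- partial sum.
  partialSums-split : {u v : I → ℝ} {t : ℝ} → Nonneg u → Nonneg v →
    PartialSums≤ (λ i → u i + v i) t → ∀ {xs ys} → Unique xs → Unique ys →
    sumOver u xs + sumOver v ys ≤ t
  partialSums-split {u = u} {v} hu hv b {xs} {ys} xs! ys! =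
    ≤-trans (+-mono-≤ (sum-⊆ hu xs! (⊆-unionˡ xs ys)) (sum-⊆ hv ys! (⊆-unionʳ xs ys)))
      (≤-trans (≤-reflexive (≈-sym (sum-+ u v zs))) (b zs (union-! xs ys)))
    where
    zs : List _
    zs = union xs ys

  swap-! : {xs : List (I × J)} → Unique xs → Unique (map swap xs)
  swap-! = Unique.map⁺ λ { ≡.refl → ≡.refl }

  partialSums-swap : {u : I × J → ℝ} {t : ℝ} → PartialSums≤ u t → PartialSums≤ (u ∘ swap) t
  partialSums-swap {u = u} b xs xs! =
    ≤-trans (≤-reflexive (reflexive (≡.sym (sum-map u swap xs)))) (b (map swap xs) (swap-! xs!))

  -- Twice a sum of `v` is a sum of `v` plus a sum of `v ∘ swap` over the reversed list, and the two
  -- lists together fit under `t`.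
  partialSums-oriented : {v : I × I → ℝ} {t : ℝ} → Nonneg v →
    PartialSums≤ (λ e → v e + v (swap e)) t → PartialSums≤ v (½ * t)
  partialSums-oriented {v = v} {t} hv b xs xs! = *-cancelˡ-≤ 0<2 (≤-trans (≤-reflexive (begin
      2# * sumOver v xs                                   ≈⟨ solve 1 (λ x → (:1 :+ :1) :* x
          := x :+ x) ≈-refl _ ⟩
      sumOver v xs + sumOver (v ∘ swap ∘ swap) xs         ≡⟨ ≡.cong (sumOver v xs +_)
          (sum-map (v ∘ swap) swap xs) ⟨
      sumOver v xs + sumOver (v ∘ swap) (map swap xs)     ∎))
    (≤-trans (partialSums-split hv (hv ∘ swap) b xs! (swap-! xs!)) (≤-reflexive (begin
      t                ≈⟨ ½+½ t ⟨
      ½ * t + ½ * t    ≈⟨ solve 1 (λ x → x :+ x := (:1 :+ :1) :* x) ≈-refl _ ⟩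
      2# * (½ * t)     ∎))))

  sum-cartesianProduct : (u : I × J → ℝ) → ∀ xs ys →
    sumOver u (cartesianProduct xs ys) ≈ sumOver (λ x → sumOver (λ y → u (x , y)) ys) xs
  sum-cartesianProduct u []       ys = ≈-refl
  sum-cartesianProduct u (x ∷ xs) ys = ≈-trans (sum-++ u (map (x ,_) ys) (cartesianProduct xs ys))
    (+-cong (reflexive (sum-map u (x ,_) ys)) (sum-cartesianProduct u xs ys))

  -- A finite list of pairs lies in the product of its two projections, and a product can be summed
  -- row by row.
  partialSums-fubini : {u : I × J → ℝ} {v : I → ℝ} {t : ℝ} → Nonneg u →
    (∀ x → PartialSums≤ (λ y → u (x , y)) (v x)) → PartialSums≤ v t → PartialSums≤ u t
  partialSums-fubini {u = u} hu rows b es es! =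
    ≤-trans (sum-⊆ hu es! λ {e} p → ∈-cartesianProduct⁺ {x = proj₁ e} {y = proj₂ e}
        (⊆-unionˡ (map proj₁ es) [] (∈-map⁺ proj₁ p)) (⊆-unionˡ (map proj₂ es) [] (∈-map⁺ proj₂ p)))
      (≤-trans (≤-reflexive (sum-cartesianProduct u xs ys))
        (≤-trans (sum-mono-∀ (λ x → rows x ys (union-! (map proj₂ es) [])) xs)
          (b xs (union-! (map proj₁ es) []))))
    where
    xs : List _
    xs = union (map proj₁ es) []
    ys : List _
    ys = union (map proj₂ es) []

  module _ {u : I → ℝ} {s : ℝ} (hu : Nonneg u) (h : HasSum u s) where

    hasSum⇒partialSums≤ : PartialSums≤ u s
    hasSum⇒partialSums≤ ys ys! = ≮⇒≥ λ s<Σ → let (xs , xs! , close) = h _ (<⇒0<- s<Σ) in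
      <⇒≱ (close (union xs ys) (union-! xs ys) (⊆-unionˡ xs ys))
        (≤-trans (≤-by (sum-⊆ hu ys! (⊆-unionʳ xs ys))
            (solve 3 (λ a b s → (b :- s) :- (a :- s) := b :- a) ≈-refl _ _ s))
          (x≤∣x∣ _))

    hasSum-least : ∀ {t} → PartialSums≤ u t → s ≤ t
    hasSum-least {t} b = ≮⇒≥ λ t<s → let (xs , xs! , close) = h _ (<⇒0<- t<s) in
      <⇒≱ (close xs xs! (λ p → p))
        (≤-trans (≤-by (b xs xs!) (solve 3 (λ a s t → (:- (a :- s)) :- (s :- t) := t :- a) ≈-refl _ s t))
          (-x≤∣x∣ _))

  -- Truncations and the co-area inequality

  pos : ℝ → ℝ
  pos a = a ⊔ 0#

  0≤pos : ∀ a → 0# ≤ pos a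
  0≤pos a = x≤y⊔x a 0#

  x≤pos : ∀ a → a ≤ pos a
  x≤pos a = x≤x⊔y a 0#

  -- If u ≤ b, the truncated difference is nonpositive, so `b′` needs control only for b ≤ u. This
  -- covers both raising the truncation height and removing the truncation.
  truncation-mono : ∀ {a b a′ b′ u} → a ⊓ u ≤ a′ → (b ≤ u → b′ ≤ b) →
    pos (a ⊓ u - b ⊓ u) ≤ pos (a′ - b′)
  truncation-mono {a} {b} {a′} {b′} {u} p q = ⊔-lub (below (total b u)) (0≤pos _)
    where
    below : b ≤ u ⊎ u ≤ b → a ⊓ u - b ⊓ u ≤ pos (a′ - b′)
    below (inj₁ b≤u) = ≤-trans (+-mono-≤ p
        (neg-mono-≤ (≤-trans (q b≤u) (≤-reflexive (≈-sym (x≤y⇒x⊓y≈x b≤u))))))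
      (x≤pos _)
    below (inj₂ u≤b) = ≤-trans (≤-by (x⊓y≤y a u)
      (≈-trans (+-congˡ (-‿cong (+-congˡ (-‿cong (x≤y⇒y⊓x≈x u≤b)))))
        (solve 2 (λ a u → :0 :- (a :- u) := u :- a) ≈-refl (a ⊓ u) u))) (0≤pos _)

  -- The co-area inequality, by continuous induction on the truncation height s
  -- of G (no integral over the levels is needed).
  module _ {X : Set} (β : X × X → ℝ) (0≤β : Nonneg β) (G : X → ℝ) (0≤G : Nonneg G)
    (m : X → ℝ) (0≤m : Nonneg m) (c : ℝ) (0≤c : 0# ≤ c)
    (isoperimetric : ∀ s → 0# ≤ s → ∀ F → Unique F → All (λ x → s < G x) F →
      ∃[ E ] (Unique E × All (λ (x , y) → s < G x × G y ≤ s) E × c * sumOver m F ≤ sumOver β E))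
    where

    private
      flow : ℝ → X × X → ℝ
      flow s (x , y) = β (x , y) * pos (G x ⊓ s - G y ⊓ s)

      0≤flow : ∀ s → Nonneg (flow s)
      0≤flow s e = *-nonneg (0≤β e) (0≤pos _)

      flow-mono : ∀ {s t} → s ≤ t → ∀ e → flow s e ≤ flow t e
      flow-mono {s} {t} s≤t e@(x , y) = *-monoˡ-≤ (0≤β e) (truncation-mono
        (⊓-glb (x⊓y≤x (G x) s) (≤-trans (x⊓y≤y (G x) s) s≤t)) (λ _ → x⊓y≤x (G y) t))

      flow-grow : ∀ {s η} → 0# ≤ η → ∀ {e@(x , y) : X × X} → s + η ≤ G x → G y ≤ s →
        η * β e ≤ flow (s + η) e - flow s e
      flow-grow {s} {η} 0≤η {e@(x , y)} s+η≤Gx Gy≤s = ≤-reflexive (≈-sym (begin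
        flow (s + η) e - flow s e
          ≈⟨ +-cong (*-congˡ (value (s + η) s+η≤Gx Gy≤s+η))
              (-‿cong (*-congˡ (value s (≤-trans s≤s+η s+η≤Gx) Gy≤s))) ⟩
        β e * ((s + η) - G y) - β e * (s - G y)
          ≈⟨ solve 4 (λ b s n g → b :* (s :+ n :- g) :- b :* (s :- g) := n :* b) ≈-refl (β e) s η (G y) ⟩
        η * β e ∎))
        where
        s≤s+η : s ≤ s + η
        s≤s+η = ≤-by 0≤η (solve 2 (λ s n → s :+ n :- s := n :- :0) ≈-refl s η)
        Gy≤s+η : G y ≤ s + η
        Gy≤s+η = ≤-trans Gy≤s s≤s+η
        value : ∀ t → t ≤ G x → G y ≤ t → pos (G x ⊓ t - G y ⊓ t) ≈ t - G y
        value t t≤Gx Gy≤t = ≈-trans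
          (⊔-cong (+-cong (x≤y⇒y⊓x≈x t≤Gx) (-‿cong (x≤y⇒x⊓y≈x Gy≤t))) ≈-refl)
          (x≤y⇒y⊔x≈y (≤⇒0≤- Gy≤t))

    module _ (F : List X) (F! : Unique F) where
      private
        -- The integral over the levels from 0 to `s` of the mass of the points of `F` above the
        -- level, for s ≥ 0.
        volume : ℝ → ℝ
        volume s = sumOver (λ x → m x * (G x ⊓ s)) F

        -- Compares `c * volume s` with the total flow through every upper bound of the latter,
        -- since the total may be infinite.
        Reached : ℝ → Set
        Reached s = ∀ t → PartialSums≤ (flow s) t → c * volume s ≤ t

        -- A crude upper bound for `G` on `F`: at this height truncation leaves the volume
        -- unchanged.
        top : ℝ
        top = sumOver G F

        G≤top : ∀ xs → All (λ x → G x ≤ sumOver G xs) xs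
        G≤top []       = []
        G≤top (x ∷ xs) = ≤-by (sum-nonneg 0≤G xs) (solve 2 (λ g s → g :+ s :- g := s :- :0) ≈-refl (G x) _)
          ∷ All.map (λ p → ≤-trans p (≤-by (0≤G x) (solve 2 (λ g s → g :+ s :- s := g :- :0)
              ≈-refl (G x) _))) (G≤top xs)

        Level : Pred ℝ 0ℓ
        Level s = 0# ≤ s × s ≤ top × Reached s

        level-0 : Level 0#
        level-0 = ≤-refl , sum-nonneg 0≤G F , λ t b → ≤-trans
          (≤-trans (*-monoˡ-≤ 0≤c (sum-nonpos
              (λ x → ≤-trans (*-monoˡ-≤ (0≤m x) (x⊓y≤y (G x) 0#)) (≤-reflexive (zeroʳ _))) F))
            (≤-reflexive (zeroʳ c)))
          (b [] [])

        above : ℝ → List X → List X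
        above s = filter (λ x → em {s < G x})

        volume-step : ∀ s η → 0# ≤ η → ∀ xs → sumOver (λ x → m x * (G x ⊓ (s + η))) xs ≤
          sumOver (λ x → m x * (G x ⊓ s)) xs + η * sumOver m (above s xs)
        volume-step s η 0≤η []       = ≤-reflexive (solve 1 (λ n → :0 := :0 :+ n :* :0) ≈-refl η)
        volume-step s η 0≤η (x ∷ xs) with em {s < G x}
        ... | yes s<Gx = ≤-by₂ (*-monoˡ-≤ (0≤m x) (≤-trans (x⊓y≤y (G x) (s + η))
                (+-monoˡ-≤ η (≤-reflexive (≈-sym (x≤y⇒y⊓x≈x (<⇒≤ s<Gx)))))))
              (volume-step s η 0≤η xs)
              (solve 7 (λ m a n M S T b → (m :* a :+ S :+ n :* (m :+ M)) :- (m :* b :+ T)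
                := (m :* (a :+ n) :- m :* b) :+ (S :+ n :* M :- T)) ≈-refl (m x) _ η _ _ _ _)
        ... | no  s≮Gx = ≤-by₂ (*-monoˡ-≤ (0≤m x) (≤-trans (x⊓y≤x (G x) (s + η))
                (⊓-glb ≤-refl (≮⇒≥ s≮Gx))))
              (volume-step s η 0≤η xs)
              (solve 6 (λ m a nM S T b → (m :* a :+ S :+ nM) :- (m :* b :+ T)
                := (m :* a :- m :* b) :+ (S :+ nM :- T)) ≈-refl (m x) _ _ _ _ _)

        volume-≤ : ∀ s η → 0# ≤ η → volume (s + η) ≤ volume s + η * sumOver m F
        volume-≤ s η 0≤η = ≤-trans (volume-step s η 0≤η F) (+-mono-≤ ≤-refl
          (*-monoˡ-≤ 0≤η (sum-⊆ 0≤m (Unique.filter⁺ _ F!) (λ p → proj₁ (∈-filter⁻ _ {xs = F} p)))))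

        volume-mono : ∀ {s t} → s ≤ t → volume s ≤ volume t
        volume-mono {s} {t} s≤t = sum-mono-∀ (λ x → *-monoˡ-≤ (0≤m x)
          (⊓-glb (x⊓y≤x (G x) s) (≤-trans (x⊓y≤y (G x) s) s≤t))) F

        -- Finiteness of the edge list gives a positive step: the smallest excess of G x over `s`,
        -- or `d`. Every listed edge then crosses all levels from `s` to s + η.
        room : ∀ s d → 0# < d → ∀ {E : List (X × X)} → All (λ (x , y) → s < G x × G y ≤ s) E →
          ∃[ η ] (0# < η × η ≤ d × All (λ (x , y) → s + η ≤ G x × G y ≤ s) E)
        room s d 0<d [] = d , 0<d , ≤-refl , []
        room s d 0<d {(x , y) ∷ E} ((s<Gx , Gy≤s) ∷ ps) = pick (total d (G x - s))
          where
          s+η≤Gx : ∀ {η} → η ≤ G x - s → s + η ≤ G x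
          s+η≤Gx p = ≤-by p (solve 3 (λ s n g → g :- (s :+ n) := (g :- s) :- n) ≈-refl s _ (G x))
          pick : d ≤ G x - s ⊎ G x - s ≤ d →
            ∃[ η ] (0# < η × η ≤ d × All (λ (x , y) → s + η ≤ G x × G y ≤ s) ((x , y) ∷ E))
          pick (inj₁ d≤) = let (η , 0<η , η≤ , qs) = room s d 0<d ps in
            η , 0<η , η≤ , (s+η≤Gx (≤-trans η≤ d≤) , Gy≤s) ∷ qs
          pick (inj₂ ≤d) = let (η , 0<η , η≤ , qs) = room s (G x - s) (<⇒0<- s<Gx) ps in
            η , 0<η , ≤-trans η≤ ≤d , (s+η≤Gx η≤ , Gy≤s) ∷ qs

        -- Over the step the edges of `E` gain flow η β(E), which is at least c η times the mass
        -- above `s`, hence at least `c` times the gain in volume.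
        advance-by : ∀ {s η E} → 0# < η → Unique E → All (λ (x , y) → s + η ≤ G x × G y ≤ s) E →
          c * sumOver m (above s F) ≤ sumOver β E → Reached s → Reached (s + η)
        advance-by {s} {η} {E} 0<η E! steep cut reached t b = ≤-by₃
            (*-monoˡ-≤ 0≤c (volume-step s η (<⇒≤ 0<η) F))
            -- The flow at the higher level contains the flow at `s` together with the gain on `E`,
            -- so the bound for the former drops by that gain.
            (reached (t - η * sumOver β E) (λ E′ E′! → ≤-by (growth E′ E′!)
              (solve 3 (λ t n f → t :- n :- f := t :- (f :+ n))
                  ≈-refl t (η * sumOver β E) (sumOver (flow s) E′))))
            (*-monoˡ-≤ (<⇒≤ 0<η) cut)
            (solve 7 (λ c v w n M t B → t :- c :* v := (c :* (w :+ n :* M) :- c :* v)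
                 :+ (t :- n :* B :- c :* w) :+ (n :* B :- n :* (c :* M))) ≈-refl
               c (volume (s + η)) (volume s) η (sumOver m (above s F)) t (sumOver β E))
          where
          s≤s+η : s ≤ s + η
          s≤s+η = ≤-by (<⇒≤ 0<η) (solve 2 (λ s n → s :+ n :- s := n :- :0) ≈-refl s η)

          growth : ∀ E′ → Unique E′ → sumOver (flow s) E′ + η * sumOver β E ≤ t
          growth E′ E′! = ≤-trans (+-mono-≤ ≤-refl (≤-trans (≤-reflexive (≈-sym (sum-* η β E)))
              (sum-mono {v = λ e → flow (s + η) e - flow s e} (λ (p , q) → flow-grow (<⇒≤ 0<η) p q) steep)))
            (partialSums-split (0≤flow s) (λ e → ≤⇒0≤- (flow-mono s≤s+η e))
              (partialSums-mono (λ e → ≤-reflexive (solve 2 (λ a b → a :+ (b :- a) := b)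
                  ≈-refl (flow s e) (flow (s + η) e))) b)
              E′! E!)

        advance : ∀ {s} → 0# ≤ s → s < top → Reached s → ∃[ η ] (0# < η × s + η ≤ top × Reached (s + η))
        advance {s} 0≤s s<top reached
          with isoperimetric s 0≤s (above s F) (Unique.filter⁺ (λ x → em) F!) (all-filter (λ x → em) F)
        ... | E , E! , steep , cut with room s (top - s) (<⇒0<- s<top) steep
        ...   | η , 0<η , η≤ , steep′ = η , 0<η
                , ≤-by η≤ (solve 3 (λ s n t → t :- (s :+ n) := (t :- s) :- n) ≈-refl s η top)
                , advance-by 0<η E! steep′ cut reached

        -- `volume` is Lipschitz in the height with constant m(F) and the flow is monotone, so the
        -- inequality passes to the limit from levels close to the supremum.
        reached-sup : ∀ {s*} → IsSup _≤_ Level id s* → Reached s*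
        reached-sup {s*} s*-sup t b = x≤y+εk⇒x≤y (*-nonneg 0≤c (sum-nonneg 0≤m F)) bound
          where
          bound : ∀ ε → 0# < ε → c * volume s* ≤ t + ε * (c * sumOver m F)
          bound ε 0<ε with sup-approximated s*-sup ε 0<ε
          ... | s , Ls@(_ , _ , reached) , s*≤ = ≤-by₂
            (*-monoˡ-≤ 0≤c (≤-trans (volume-mono s*≤) (volume-≤ s ε (<⇒≤ 0<ε))))
            (reached t (partialSums-mono (flow-mono (IsSup.bound s*-sup Ls)) b))
            (solve 6 (λ t c M d v w → (t :+ d :* (c :* M)) :- c :* v
                := (c :* (w :+ d :* M) :- c :* v) :+ (t :- c :* w)) ≈-refl
              t c (sumOver m F) ε (volume s*) (volume s))

        closed : ∀ {s} → IsSup _≤_ Level id s → Level s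
        closed s-sup = IsSup.bound s-sup level-0 , IsSup.least s-sup (λ (_ , s≤top , _) → s≤top) ,
            reached-sup s-sup

        advance-level : ∀ {s} → Level s → s < top → ∃[ η ] (0# < η × Level (s + η))
        advance-level (0≤s , _ , reached) s<top = let (η , 0<η , s+η≤top , reached′) = advance 0≤s s<top reached in
          η , 0<η , +-nonneg 0≤s (<⇒≤ 0<η) , s+η≤top , reached′

        reached-top : Reached top
        reached-top = let (s , (_ , s≤top , reached) , top≤s) =
                             continuous-induction Level level-0 (λ (_ , q , _) → q) closed advance-level
          in λ t b → ≤-trans (*-monoˡ-≤ 0≤c (volume-mono top≤s))
              (reached t (partialSums-mono (flow-mono s≤top) b))

      coarea : ∀ t → PartialSums≤ (λ (x , y) → β (x , y) * pos (G x - G y)) t →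
        c * sumOver (λ x → m x * G x) F ≤ t
      coarea t b = ≤-trans
        (*-monoˡ-≤ 0≤c (sum-mono (λ {x} p → *-monoˡ-≤ (0≤m x) (⊓-glb ≤-refl p)) (G≤top F)))
        (reached-top t (partialSums-mono (λ e@(x , y) → *-monoˡ-≤ (0≤β e)
          (truncation-mono (x⊓y≤x (G x) top) (λ _ → ≤-refl))) b))

-- Nodal parts as test functions

module Contractions (em : ExcludedMiddle 0ℓ) (R : CompleteOrderedField) (Pow : RealPower R) where
  open CompleteOrderedField R hiding (refl; sym; trans)
  open OrderedField R
  open ClassicalOrder em R
  open RealPower Pow
  open Powers em R Pow
  open PowerInequalities em R Pow
  open SetoidReasoning setoid

  -- The nodal parts f ⊔ 0 and f ⊓ 0 of a function f, and f itself, are ν ∘ f for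
  -- contractions ν.
  record Contraction (ν : ℝ → ℝ) : Set where
    field
      monotone    : ∀ {a b} → b ≤ a → ν b ≤ ν a
      lipschitz   : ∀ {a b} → b ≤ a → ν a - ν b ≤ a - b
      alternative : ∀ a → ν a ≈ 0# ⊎ ν a ≈ a

    ∣ν∣≤ : ∀ a → ∣ ν a ∣ ≤ ∣ a ∣
    ∣ν∣≤ a with alternative a
    ... | inj₁ e = ≤-trans (≤-reflexive (≈-trans (∣∣-cong e) (0≤x⇒∣x∣≈x ≤-refl))) (0≤∣x∣ a)
    ... | inj₂ e = ≤-reflexive (∣∣-cong e)

    private
      ∣ν-ν∣≤-ordered : ∀ {a b} → b ≤ a → ∣ ν a - ν b ∣ ≤ ∣ a - b ∣
      ∣ν-ν∣≤-ordered b≤a = ≤-trans (≤-reflexive (0≤x⇒∣x∣≈x (≤⇒0≤- (monotone b≤a))))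
        (≤-trans (lipschitz b≤a) (x≤∣x∣ _))

    ∣ν-ν∣≤ : ∀ a b → ∣ ν a - ν b ∣ ≤ ∣ a - b ∣
    ∣ν-ν∣≤ a b with total b a
    ... | inj₁ b≤a = ∣ν-ν∣≤-ordered b≤a
    ... | inj₂ a≤b = ≤-trans (≤-reflexive (∣x-y∣≈∣y-x∣ (ν a) (ν b)))
      (≤-trans (∣ν-ν∣≤-ordered a≤b) (≤-reflexive (∣x-y∣≈∣y-x∣ b a)))

  id-contraction : Contraction id
  id-contraction = record { monotone = id ; lipschitz = λ _ → ≤-refl ; alternative = λ _ → inj₂ ≈-refl }

  ⊔0-contraction : Contraction (_⊔ 0#)
  ⊔0-contraction = record
    { monotone = λ {a} {b} b≤a → ⊔-lub (≤-trans b≤a (x≤x⊔y a 0#)) (x≤y⊔x a 0#)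
    ; lipschitz = λ {a} {b} b≤a → ≤-by (⊔-lub {x = (b ⊔ 0#) + (a - b)}
        (≤-by (x≤x⊔y b 0#) (solve 3 (λ a b c → c :+ (a :- b) :- a := c :- b) ≈-refl a b (b ⊔ 0#)))
        (+-nonneg (x≤y⊔x b 0#) (≤⇒0≤- b≤a)))
        (solve 4 (λ a b c d → (a :- b) :- (d :- c) := (c :+ (a :- b)) :- d) ≈-refl a b (b ⊔ 0#) (a ⊔ 0#))
    ; alternative = λ a → [ (λ 0≤a → inj₂ (x≤y⇒y⊔x≈y 0≤a)) , (λ a≤0 → inj₁ (x≤y⇒x⊔y≈y a≤0)) ]′ (total 0# a)
    }

  ⊓0-contraction : Contraction (_⊓ 0#)
  ⊓0-contraction = record
    { monotone = λ {a} {b} b≤a → ⊓-glb (≤-trans (x⊓y≤x b 0#) b≤a) (x⊓y≤y b 0#)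
    ; lipschitz = λ {a} {b} b≤a → ≤-by (⊓-glb {(a ⊓ 0#) - (a - b)}
        (≤-by (x⊓y≤x a 0#) (solve 3 (λ a b c → b :- (c :- (a :- b)) := a :- c) ≈-refl a b (a ⊓ 0#)))
        (≤-by₂ (x⊓y≤y a 0#) (≤⇒0≤- b≤a) (solve 3 (λ a b c → :0 :- (c :- (a :- b))
            := (:0 :- c) :+ (a :- b :- :0)) ≈-refl a b (a ⊓ 0#))))
        (solve 4 (λ a b c d → (a :- b) :- (d :- c) := c :- (d :- (a :- b))) ≈-refl a b (b ⊓ 0#) (a ⊓ 0#))
    ; alternative = λ a → [ (λ 0≤a → inj₁ (x≤y⇒y⊓x≈x 0≤a)) , (λ a≤0 → inj₂ (x≤y⇒x⊓y≈x a≤0)) ]′ (total 0# a)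
    }

  module SignedPower (p : ℝ) (1<p : 1# < p) where
    open Exponent p 1<p

    private
      -- Unfolds to the same expression as `φ G p`, without the graph argument.
      φ′ : ℝ → ℝ
      φ′ t = ∣ t ∣ ^ (p - 2#) * t

    φ-cong : ∀ {s t} → s ≈ t → φ′ s ≈ φ′ t
    φ-cong e = *-cong (^-congˡ (∣∣-cong e)) e

    φ-odd : ∀ s t → φ′ (s - t) ≈ - φ′ (t - s)
    φ-odd s t = ≈-trans (*-cong (^-congˡ (∣x-y∣≈∣y-x∣ s t)) ≈-refl)
      (solve 3 (λ y s t → y :* (s :- t) := :- (y :* (t :- s))) ≈-refl _ s t)

    φ-pos : ∀ {t} → 0# < t → φ′ t ≈ t ^ p-1
    φ-pos {t} 0<t = begin
      ∣ t ∣ ^ (p - 2#) * t     ≈⟨ *-congʳ (^-cong (0≤x⇒∣x∣≈x (<⇒≤ 0<t)) (solve 1 (λ p → p :- (:1 :+ :1)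
          := p :- :1 :- :1) ≈-refl p)) ⟩
      t ^ (p-1 - 1#) * t       ≈⟨ ^-pred p-1 0<t ⟨
      t ^ p-1                  ∎

    ∣∣^-0 : ∀ {t} → t ≈ 0# → ∣ t ∣ ^ p ≈ 0#
    ∣∣^-0 e = ≈-trans (^-congˡ (≈-trans (∣∣-cong e) (0≤x⇒∣x∣≈x ≤-refl))) (0^ 0<p)

    ∣∣^-pos : ∀ {t} → 0# < t → ∣ t ∣ ^ p ≈ t ^ p-1 * t
    ∣∣^-pos 0<t = ≈-trans (^-congˡ (0≤x⇒∣x∣≈x (<⇒≤ 0<t))) (^-pred p 0<t)

    0≤∣∣^ : ∀ t → 0# ≤ ∣ t ∣ ^ p
    0≤∣∣^ t = ^-nonneg 0<p (0≤∣x∣ t)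

    0<∣∣ : ∀ {t} → ¬ (t ≈ 0#) → 0# < ∣ t ∣
    0<∣∣ {t} t≉0 = 0≤∣x∣ t , λ e → t≉0 (antisym
      (≤-trans (x≤∣x∣ t) (≤-reflexive (≈-sym e)))
      (≤-by (≤-trans (-x≤∣x∣ t) (≤-reflexive (≈-sym e))) (solve 1 (λ t → t :- :0 := :0 :- (:- t)) ≈-refl t)))

    0<∣∣^ : ∀ {t} → ¬ (t ≈ 0#) → 0# < ∣ t ∣ ^ p
    0<∣∣^ t≉0 = ^-pos p (0<∣∣ t≉0)

    φ-* : ∀ t → φ′ t * t ≈ ∣ t ∣ ^ p
    φ-* t with em {t ≈ 0#}
    ... | yes e = ≈-trans (*-congˡ e) (≈-trans (zeroʳ _) (≈-sym (∣∣^-0 e)))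
    ... | no t≉0 with total 0# t
    ...   | inj₁ 0≤t = ≈-trans (*-congʳ (φ-pos 0<t)) (≈-sym (∣∣^-pos 0<t))
      where
      0<t : 0# < t
      0<t = 0≤t , t≉0 ∘ ≈-sym
    ...   | inj₂ t≤0 = begin
        φ′ t * t              ≈⟨ solve 2 (λ y t → y :* t :* t := y :* (:- t) :* (:- t))
            ≈-refl (∣ t ∣ ^ (p - 2#)) t ⟩
        ∣ t ∣ ^ (p - 2#) * - t * - t   ≈⟨ *-congʳ (*-congʳ (^-congˡ (∣-x∣≈∣x∣ t))) ⟨
        φ′ (- t) * - t        ≈⟨ *-congʳ (φ-pos 0<-t) ⟩
        (- t) ^ p-1 * - t     ≈⟨ ∣∣^-pos 0<-t ⟨
        ∣ - t ∣ ^ p           ≈⟨ ^-congˡ (∣-x∣≈∣x∣ t) ⟩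
        ∣ t ∣ ^ p             ∎
      where
      0<-t : 0# < - t
      0<-t = <-by (t≤0 , t≉0) (solve 1 (λ t → (:- t) :- :0 := :0 :- t) ≈-refl t)

    module _ {ν : ℝ → ℝ} (contraction : Contraction ν) where
      open Contraction contraction

      φ-mass : ∀ a → φ′ a * ν a ≈ ∣ ν a ∣ ^ p
      φ-mass a with alternative a
      ... | inj₁ e = ≈-trans (≈-trans (*-congˡ e) (zeroʳ _)) (≈-sym (∣∣^-0 e))
      ... | inj₂ e = begin
        φ′ a * ν a      ≈⟨ *-congʳ (φ-cong e) ⟨
        φ′ (ν a) * ν a  ≈⟨ φ-* (ν a) ⟩
        ∣ ν a ∣ ^ p     ∎

      private
        φ-energy-ordered : ∀ {a b} → b ≤ a → ∣ ν a - ν b ∣ ^ p ≤ φ′ (a - b) * (ν a - ν b)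
        φ-energy-ordered {a} {b} b≤a with 0≤⇒≈0⊎> (≤⇒0≤- (monotone b≤a))
        ... | inj₁ e = ≤-reflexive (≈-trans (∣∣^-0 e) (≈-sym (≈-trans (*-congˡ e) (zeroʳ _))))
        ... | inj₂ 0<γ = ≤-trans (≤-reflexive (∣∣^-pos 0<γ)) (≤-trans
            (*-monoʳ-≤ (<⇒≤ 0<γ) (^-monoˡ 0<p-1 (<⇒≤ 0<γ) (lipschitz b≤a)))
            (≤-reflexive (*-congʳ (≈-sym (φ-pos (<-≤-trans 0<γ (lipschitz b≤a)))))))

      -- For b ≤ a put γ = ν a - ν b, so 0 ≤ γ ≤ a - b and γ^p = γ^(p-1) γ ≤ (a - b)^(p-1) γ.
      -- Oddness of φ covers the other order.
      φ-energy : ∀ a b → ∣ ν a - ν b ∣ ^ p ≤ φ′ (a - b) * (ν a - ν b)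
      φ-energy a b with total b a
      ... | inj₁ b≤a = φ-energy-ordered b≤a
      ... | inj₂ a≤b = ≤-trans (≤-reflexive (^-congˡ (∣x-y∣≈∣y-x∣ (ν a) (ν b))))
        (≤-trans (φ-energy-ordered a≤b) (≤-reflexive (begin
          φ′ (b - a) * (ν b - ν a)     ≈⟨ *-congʳ (φ-odd b a) ⟩
          - φ′ (a - b) * (ν b - ν a)   ≈⟨ solve 3 (λ y c d → (:- y) :* (d :- c) := y :* (c :- d))
              ≈-refl (φ′ (a - b)) (ν a) (ν b) ⟩
          φ′ (a - b) * (ν a - ν b)     ∎)))

-- Arithmetic of extended reals and infinite sums

module ExtendedReals (em : ExcludedMiddle 0ℓ) (R : CompleteOrderedField) (Pow : RealPower R) where
  open Analysis em R Pow hiding (refl; sym; trans)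
  open OrderedField R
  open ClassicalOrder em R
  open Sums em R Pow
  module E = ExtremaOrder _≤_

  [x]≰⊥ : ∀ {x} → ¬ ([ x ] ≤± ⊥±)
  [x]≰⊥ (AddSupremum.[_] ())

  ≤±-reflexive : ∀ {e f} → e ≈± f → e ≤± f
  ≤±-reflexive = E.≤±-reflexive ≤-reflexive

  ≈±-sym : ∀ {e f} → e ≈± f → f ≈± e
  ≈±-sym = ExtremaEquality.≈±-sym _≈_ ≈-sym

  ≤±-trans : ∀ {e f g} → e ≤± f → f ≤± g → e ≤± g
  ≤±-trans = E.≤±-trans ≤-trans

  <∞-mono : ∀ {e f} → e ≤± f → f <∞ → e <∞
  <∞-mono e≤f (r , f≤r) = r , ≤±-trans e≤f f≤r

  ·-<∞ : ∀ {e} c → e <∞ → (c · e) <∞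
  ·-<∞ {⊥±}    c _ = 0# , E.⊥±≤ _
  ·-<∞ {[ x ]} c _ = c * x , E.[ ≤-refl ]

  ·-<∞⁻ : ∀ {e} c → (c · e) <∞ → e <∞
  ·-<∞⁻ {⊥±}    c _ = 0# , E.⊥±≤ _
  ·-<∞⁻ {[ x ]} c _ = x , E.[ ≤-refl ]

  ^-<∞ : ∀ {e} s → e <∞ → (e ^± s) <∞
  ^-<∞ {⊥±}    s _ = 0# , E.⊥±≤ _
  ^-<∞ {[ x ]} s _ = x ^ s , E.[ ≤-refl ]

  ^-<∞⁻ : ∀ {e} s → (e ^± s) <∞ → e <∞
  ^-<∞⁻ {⊥±}    s _ = 0# , E.⊥±≤ _
  ^-<∞⁻ {[ x ]} s _ = x , E.[ ≤-refl ]

  ÷-≤ : ∀ {e w z} → 0# < w → e ≤± [ z ] → (e ÷ [ w ]) ≤± [ w ⁻¹ * z ]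
  ÷-≤ {⊥±}    0<w _ = E.⊥±≤ _
  ÷-≤ {[ x ]} 0<w h = E.[ *-monoˡ-≤ (<⇒≤ (⁻¹-pos 0<w)) (E.[≤]-injective h) ]

  0≤÷ : ∀ {e f} → [ 0# ] ≤± e → (∀ {w} → f ≡ [ w ] → 0# < w) → [ 0# ] ≤± (e ÷ f)
  0≤÷ {e} {⊥±} _ _ = E.[ ≤-refl ]
  0≤÷ {e} {⊤±} _ _ = E.[ ≤-refl ]
  0≤÷ {[ x ]} {[ w ]} h pos = E.[ *-nonneg (<⇒≤ (⁻¹-pos (pos ≡.refl))) (E.[≤]-injective h) ]
  0≤÷ {⊤±} {[ w ]} h pos = _ E.≤⊤±
  0≤÷ {⊥±} {[ w ]} h pos = ⊥-elim ([x]≰⊥ h)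

  -- Leaves a strict margin above `K`, against which the weak inequalities of the co-area argument
  -- give a contradiction.
  ≰-gap : ∀ {e K} → ¬ (e ≤± [ K ]) → ∃[ c ] (K < c × ¬ (e ≤± [ c ]))
  ≰-gap {⊥±}        h = ⊥-elim (h (E.⊥±≤ _))
  ≰-gap {[ x ]} {K} h = let (c , K<c , c<x) = dense (≰⇒> (λ q → h E.[ q ])) in
    c , K<c , λ q → <⇒≱ c<x (E.[≤]-injective q)
  ≰-gap {⊤±} {K}    h = K + 1# , <-by 0<1 (solve 1 (λ k → k :+ :1 :- k := :1 :- :0) ≈-refl K) , λ ()

  module _ {I : Set} {A : Pred I 0ℓ} {u : I → ℝ} where

    ∑-≥ : ∀ {xs} → Unique xs → All A xs → [ sumOver u xs ] ≤± ∑ A u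
    ∑-≥ xs! Axs = IsSup.bound (proj₂ (sup-exists (λ xs → Unique xs × All A xs) (λ xs → [ sumOver u xs ])))
        (xs! , Axs)

    ∑-≤ : ∀ {e} → (∀ xs → Unique xs → All A xs → [ sumOver u xs ] ≤± e) → ∑ A u ≤± e
    ∑-≤ h = IsSup.least (proj₂ (sup-exists (λ xs → Unique xs × All A xs) (λ xs → [ sumOver u xs ])))
      λ {xs} (xs! , Axs) → h xs xs! Axs

    0≤∑ : [ 0# ] ≤± ∑ A u
    0≤∑ = ∑-≥ {[]} [] []

    ∑-finite : ∑ A u <∞ → ∃[ s ] (∑ A u ≡ [ s ])
    ∑-finite = finite 0≤∑
      where
      finite : ∀ {e} → [ 0# ] ≤± e → e <∞ → ∃[ s ] (e ≡ [ s ])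
      finite {⊥±}    0≤e _ = ⊥-elim ([x]≰⊥ 0≤e)
      finite {[ x ]} _   _ = x , ≡.refl
      finite {⊤±} _ (r , ())

    ∑-value-≥ : ∀ {s} → ∑ A u ≡ [ s ] → ∀ xs → Unique xs → All A xs → sumOver u xs ≤ s
    ∑-value-≥ e xs xs! Axs = E.[≤]-injective (≡.subst (_ ≤±_) e (∑-≥ xs! Axs))

  ∑-bounded⁻ : {I : Set} {u : I → ℝ} {t : ℝ} → ∑ U u ≤± [ t ] → PartialSums≤ u t
  ∑-bounded⁻ {u = u} h xs xs! = E.[≤]-injective (≤±-trans (∑-≥ {A = U} {u = u} xs! (All.universal _ xs)) h)

  ∑-bounded : {I : Set} {u : I → ℝ} {t : ℝ} → PartialSums≤ u t → ∑ U u ≤± [ t ]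
  ∑-bounded b = ∑-≤ λ xs xs! _ → E.[ b xs xs! ]

  ∑-mono : {I : Set} {u v : I → ℝ} → (∀ i → u i ≤ v i) → ∑ U u ≤± ∑ U v
  ∑-mono {u = u} {v} h = ∑-≤ λ xs xs! _ →
    ≤±-trans E.[ sum-mono-∀ h xs ] (∑-≥ {A = U} {u = v} xs! (All.universal _ xs))

-- Sets of at most half the mass and their boundaries

module CheegerInequality (em : ExcludedMiddle 0ℓ) (R : CompleteOrderedField) (Pow : RealPower R) where
  open Analysis em R Pow hiding (refl; sym; trans)
  open OrderedField R
  open ClassicalOrder em R
  open Powers em R Pow
  open PowerInequalities em R Pow
  open Sums em R Pow
  open ExtendedReals em R Pow
  open Contractions em R Pow
  open SetoidReasoning setoid

  module WeightedGraph {X : Set} (G : Graph X) (M : ℝ) (mass≡M : mass G U ≡ [ M ]) where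
    open Graph G

    0≤m : ∀ x → 0# ≤ m x
    0≤m x = <⇒≤ (m-pos x)

    mass-bounded : PartialSums≤ m M
    mass-bounded = ∑-bounded⁻ (≡.subst (_≤± [ M ]) (≡.sym mass≡M) E.[ ≤-refl ])

    AtMostHalf : Pred X 0ℓ → Set
    AtMostHalf P = ∀ xs → Unique xs → All P xs → sumOver m xs ≤ ½ * M

    -- Otherwise two finite lists, each of mass above `½ * M`, concatenate to a duplicate-free list
    -- of mass above `M`.
    atMostHalf-disjoint : {P Q : Pred X 0ℓ} → (∀ {x} → P x → ¬ Q x) → AtMostHalf P ⊎ AtMostHalf Q
    atMostHalf-disjoint {P} {Q} disjoint with em {AtMostHalf P}
    ... | yes p = inj₁ p
    ... | no ¬p = inj₂ λ ys ys! Qys → ≮⇒≥ λ M/2<ys → ¬p λ xs xs! Pxs → ≮⇒≥ λ M/2<xs →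
      <⇒≱ M/2<xs (≤-by₂
        (≤-trans (≤-reflexive (≈-sym (sum-++ m xs ys)))
          (mass-bounded (xs ++ ys) (Unique.++⁺ xs! ys! λ (x∈xs , x∈ys) →
            disjoint (All.lookup Pxs x∈xs) (All.lookup Qys x∈ys))))
        (<⇒≤ M/2<ys)
        (≈-trans (solve 3 (λ h s t → h :- s := ((h :+ h) :- (s :+ t)) :+ (t :- h))
            ≈-refl (½ * M) (sumOver m xs) (sumOver m ys))
          (+-congʳ (+-congʳ (½+½ M)))))

    χ : Pred X 0ℓ → Subset G
    χ P x = isYes (em {P x})

    ∈χ : (P : Pred X 0ℓ) → ∀ {x} → T (χ P x) → P x
    ∈χ P = toWitness

    χ∋ : (P : Pred X 0ℓ) → ∀ {x} → P x → T (χ P x)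
    χ∋ P {x} p = fromWitness {a? = em {P x}} p

    module _ (W : Subset G) {x : X} (x∈W : T (W x)) where

      mass-finite : ∃[ w ] (mass G (T ∘ W) ≡ [ w ])
      mass-finite = ∑-finite (M , ∑-≤ λ xs xs! _ → E.[ mass-bounded xs xs! ])

      mass-≥ : ∀ {w} → mass G (T ∘ W) ≡ [ w ] → ∀ xs → Unique xs → All (T ∘ W) xs → sumOver m xs ≤ w
      mass-≥ = ∑-value-≥

      mass-pos : ∀ {w} → mass G (T ∘ W) ≡ [ w ] → 0# < w
      mass-pos {w} e = <-≤-trans (m-pos x)
        (≤-trans (≤-reflexive (≈-sym (+-identityʳ (m x)))) (mass-≥ e (x ∷ []) ([] ∷ []) (x∈W ∷ [])))

      mass-≤half : AtMostHalf (T ∘ W) → mass G (T ∘ W) ≤± mass G U ÷ [ 2# ]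
      mass-≤half h = ≡.subst (λ e → mass G (T ∘ W) ≤± e ÷ [ 2# ]) (≡.sym mass≡M)
        (∑-≤ λ xs xs! Wxs → E.[ h xs xs! Wxs ])

      h⁽¹⁾-≤ : ∀ {d c z} → 0# ≤ c → AtMostHalf (T ∘ W) → ∣∂_∣ G W d ≤± [ z ] →
        (∀ {w} → mass G (T ∘ W) ≡ [ w ] → z ≤ w * c) → h⁽¹⁾ G d ≤± [ c ]
      h⁽¹⁾-≤ {d} {c} {z} 0≤c half ∂≤z z≤wc with mass-finite
      ... | w , e = ≤±-trans (IsSup.bound (proj₂ (inf-exists _ _)) {W} ((x , x∈W) , mass-≤half half))
        (≡.subst (λ e → ∣∂_∣ G W d ÷ e ≤± [ c ]) (≡.sym e) (≤±-trans (÷-≤ 0<w ∂≤z)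
          E.[ *-cancelˡ-≤ 0<w (≤-trans (≤-reflexive (≈-trans (*-congˡ (*-comm (w ⁻¹) z)) (quotient z 0<w)))
              (z≤wc e)) ]))
        where
        0<w : 0# < w
        0<w = mass-pos e

    zero-cut : {P : Pred X 0ℓ} → ∀ {x} → P x → AtMostHalf P →
      (∀ {x y} → P x → ¬ P y → b x y ≤ 0#) → ∀ d → (∀ x y → 0# ≤ d x y) → h⁽¹⁾ G d ≤± [ 0# ]
    zero-cut {P} {x} Px half cut d 0≤d = h⁽¹⁾-≤ (χ P) (χ∋ P Px) {z = 0#} ≤-refl
      (λ xs xs! Pxs → half xs xs! (All.map (∈χ P) Pxs))
      (∑-≤ λ es es! ∂es → E.[ ≤-trans (sum-mono {v = λ _ → 0#} (λ {(x , y)} (Px , ¬Py) →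
          ≤-trans (*-monoʳ-≤ (0≤d x y) (cut (∈χ P Px) (¬Py ∘ χ∋ P))) (≤-reflexive (zeroˡ _))) ∂es)
        (sum-nonpos (λ _ → ≤-refl) es) ])
      (λ {w} _ → ≤-reflexive (≈-sym (zeroʳ w)))

    0≤h⁽¹⁾ : ∀ d → (∀ x y → 0# ≤ d x y) → [ 0# ] ≤± h⁽¹⁾ G d
    0≤h⁽¹⁾ d 0≤d = IsSup.least (proj₂ (inf-exists _ _)) λ {W} ((x , x∈W) , _) → 0≤÷ 0≤∑ (mass-pos W x∈W)

    CutAt : (X → X → ℝ) → ℝ → (X → ℝ) → ℝ → List X → List (X × X) → Set
    CutAt d c g s F E = Unique E × All (λ (x , y) → s < g x × g y ≤ s) E ×
      c * sumOver m F ≤ sumOver (λ (x , y) → b x y * d x y) E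

    -- The superlevel set of `g` at `s` competes in h(d). If no finite list of its boundary edges
    -- carried weight c m(F), its whole boundary would weigh at most that, and h(d) ≤ c would
    -- follow. For empty `F` the superlevel set may be empty, and the empty list serves.
    isoperimetric-cut : ∀ {d c} → 0# ≤ c → ¬ (h⁽¹⁾ G d ≤± [ c ]) → (g : X → ℝ) → AtMostHalf (λ x → 0# < g x) →
      ∀ s → 0# ≤ s → ∀ F → Unique F → All (λ x → s < g x) F → ∃[ E ] CutAt d c g s F E
    isoperimetric-cut {d} {c} 0≤c h≰c g half s 0≤s [] _ _ = [] , [] , [] , ≤-reflexive (zeroʳ c)
    isoperimetric-cut {d} {c} 0≤c h≰c g half s 0≤s F@(x ∷ _) F! s<F@(s<gx ∷ _)
      with em {∃[ E ] CutAt d c g s F E}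
    ... | yes cut = cut
    ... | no ∄cut = ⊥-elim (h≰c (h⁽¹⁾-≤ W (χ∋ P s<gx) 0≤c
        (λ xs xs! Wxs → half xs xs! (All.map (λ p → ≤-<-trans 0≤s (∈χ P p)) Wxs))
        (∑-≤ λ E E! ∂E → E.[ <⇒≤ (≰⇒> λ h → ∄cut
          (E , E! , All.map (λ (p , q) → ∈χ P p , ≮⇒≥ (q ∘ χ∋ P)) ∂E , h)) ])
        λ e → ≤-trans (*-monoˡ-≤ 0≤c (mass-≥ W (χ∋ P s<gx) e F F! (All.map (χ∋ P) s<F)))
            (≤-reflexive (*-comm c _))))
      where
      P : Pred X 0ℓ
      P x = s < g x
      W : Subset G
      W = χ P

    -- Bounding h(d) by a function of small energy

    module _ (p : ℝ) (1<p : 1# < p) where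
      open Exponent p 1<p
      open SignedPower p 1<p

      -- The factor v μ + (p-1) v^(-r) / 2 of the norm is smallest over v > 0 at v = `u μ`, where
      -- v^(-r) = 2 v μ = `V μ`; `K μ` is the minimum.
      V u K : ℝ → ℝ
      V μ = (2# * μ) ^ (p ⁻¹)
      u μ = (2# * μ) ^ (p ⁻¹ - 1#)
      K μ = ½ * (p * V μ)

      module _ {μ : ℝ} (0<μ : 0# < μ) where

        0<2μ : 0# < 2# * μ
        0<2μ = *-pos 0<2 0<μ

        0<V : 0# < V μ
        0<V = ^-pos (p ⁻¹) 0<2μ

        0<u : 0# < u μ
        0<u = ^-pos (p ⁻¹ - 1#) 0<2μ

        0<K : 0# < K μ
        0<K = *-pos 0<½ (*-pos 0<p 0<V)

        u-V : u μ * (2# * μ) ≈ V μ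
        u-V = ≈-sym (^-pred (p ⁻¹) 0<2μ)

        u^-r : u μ ^ (- r) ≈ V μ
        u^-r = begin
          u μ ^ (- r)                          ≈⟨ ^-* (p ⁻¹ - 1#) (- r) 0<2μ ⟨
          (2# * μ) ^ ((p ⁻¹ - 1#) * - r)       ≈⟨ ^-congʳ (begin
            (p ⁻¹ - 1#) * - r                    ≈⟨ solve 2 (λ i r → (i :- :1) :* (:- r)
                := (:1 :- i) :* r) ≈-refl (p ⁻¹) r ⟩
            (1# - p ⁻¹) * r                      ≈⟨ *-congʳ (+-congʳ (*-⁻¹ 0<p)) ⟨
            (p * p ⁻¹ - p ⁻¹) * r                ≈⟨ solve 3 (λ p i r → (p :* i :- i) :* r
                := i :* ((p :- :1) :* r)) ≈-refl p (p ⁻¹) r ⟩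
            p ⁻¹ * (p-1 * r)                     ≈⟨ *-congˡ p-1*r≈1 ⟩
            p ⁻¹ * 1#                            ≈⟨ *-identityʳ _ ⟩
            p ⁻¹                                 ∎) ⟩
          V μ                                  ∎

        -- By definition (V μ)^p = 2μ, and the powers of 2 cancel: 2^(p-1) · 2 · (1/2)^p = 1.
        constant : (2# ^ p-1 * (p ^ p) ⁻¹) * K μ ^ p ≈ μ
        constant = begin
          (2# ^ p-1 * (p ^ p) ⁻¹) * K μ ^ p
            ≈⟨ *-congˡ (≈-trans (*-^ p 0<½ (*-pos 0<p 0<V)) (*-congˡ (*-^ p 0<p 0<V))) ⟩
          (2# ^ p-1 * (p ^ p) ⁻¹) * (½ ^ p * (p ^ p * V μ ^ p))
            ≈⟨ *-congˡ (*-congˡ (*-congˡ (^-root 0<2μ (≈-trans (*-comm _ _) (*-⁻¹ 0<p))))) ⟩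
          (2# ^ p-1 * (p ^ p) ⁻¹) * (½ ^ p * (p ^ p * (2# * μ)))
            ≈⟨ solve 6 (λ a i h P t μ → (a :* i) :* (h :* (P :* (t :* μ)))
                := (P :* i) :* ((a :* t) :* h) :* μ)
                 ≈-refl (2# ^ p-1) ((p ^ p) ⁻¹) (½ ^ p) (p ^ p) 2# μ ⟩
          (p ^ p * (p ^ p) ⁻¹) * ((2# ^ p-1 * 2#) * ½ ^ p) * μ
            ≈⟨ *-congʳ (*-cong (*-⁻¹ (^-pos p 0<p)) (≈-trans (*-congʳ (≈-sym (^-pred p 0<2))) (^-⁻¹ p 0<2))) ⟩
          1# * 1# * μ
            ≈⟨ solve 1 (λ μ → :1 :* :1 :* μ := μ) ≈-refl μ ⟩
          μ ∎

        module NodalBound (g : X → ℝ) (0≤g : Nonneg g) (half : AtMostHalf (λ x → 0# < g x))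
          {N : ℝ} (0<N : 0# < N)
          (norm : PartialSums≤ (λ x → g x ^ p * m x) N)
          (norm-least : ∀ {t} → PartialSums≤ (λ x → g x ^ p * m x) t → N ≤ t)
          (energy : PartialSums≤ {I = X × X} (λ (x , y) → b x y * ∣ g x - g y ∣ ^ p) (2# * (μ * N)))
          where

          gᵖ : X → ℝ
          gᵖ x = g x ^ p

          0≤gᵖ : Nonneg gᵖ
          0≤gᵖ x = ^-nonneg 0<p (0≤g x)

          module _ {d : X → X → ℝ} (0≤d : ∀ x y → 0# ≤ d x y) (d-sym : ∀ x y → d x y ≈ d y x)
            (d-row : ∀ x → ∑ U (λ y → b x y * d x y ^ q) ≤± [ m x ]) where

            weight tail head : X × X → ℝ
            weight (x , y) = b x y * d x y ^ q
            tail e@(x , _) = weight e * gᵖ x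
            head e@(_ , y) = weight e * gᵖ y

            0≤weight : Nonneg weight
            0≤weight (x , y) = *-nonneg (b-nonneg x y) (^-nonneg 0<q (0≤d x y))

            weight-sym : ∀ x y → weight (x , y) ≈ weight (y , x)
            weight-sym x y = *-cong (b-sym x y) (^-congˡ (d-sym x y))

            -- The row condition bounds the total weight at `x` by `m x`, so summing the rows yields
            -- the norm of `g`.
            tail-bounded : PartialSums≤ tail N
            tail-bounded = partialSums-fubini (λ e@(x , _) → *-nonneg (0≤weight e) (0≤gᵖ x))
              (λ x → partialSums-mono (λ y → ≤-reflexive (*-comm (weight (x , y)) (gᵖ x)))
                       (partialSums-* (0≤gᵖ x) (∑-bounded⁻ (d-row x))))
              norm

            head-bounded : PartialSums≤ head N
            head-bounded = partialSums-mono (λ (x , y) → ≤-reflexive (*-congʳ (weight-sym x y)))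
              (partialSums-swap tail-bounded)

            flow majorant : X × X → ℝ
            flow (x , y) = b x y * d x y * pos (gᵖ x - gᵖ y)
            majorant e@(x , y) = u μ * (b x y * ∣ g x - g y ∣ ^ p) + p-1 * V μ * (½ * (tail e + head e))

            0≤flow : Nonneg flow
            0≤flow (x , y) = *-nonneg (*-nonneg (b-nonneg x y) (0≤d x y)) (0≤pos _)

            majorant-sym : ∀ x y → majorant (x , y) ≈ majorant (y , x)
            majorant-sym x y = +-cong
              (*-congˡ (*-cong (b-sym x y) (^-congˡ (∣x-y∣≈∣y-x∣ (g x) (g y)))))
              (*-congˡ (*-congˡ (≈-trans (+-comm _ _)
                  (+-cong (*-congʳ (weight-sym x y)) (*-congʳ (weight-sym x y))))))

            -- Only the orientation along which `g` decreases carries flow, and `edge-bound` times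
            -- `b x y` controls it.
            flow-≤-ordered : ∀ {x y} → g y ≤ g x → flow (x , y) + flow (y , x) ≤ majorant (x , y)
            flow-≤-ordered {x} {y} gy≤gx = ≤-by
              (*-monoˡ-≤ (b-nonneg x y) (edge-bound (0≤d x y) 0<u (0≤g y) gy≤gx)) (begin
              majorant (x , y) - (flow (x , y) + flow (y , x))
                ≈⟨ +-congˡ (-‿cong (+-cong (*-congˡ (x≤y⇒y⊔x≈y (≤⇒0≤- gᵖy≤gᵖx)))
                     (*-congˡ (x≤y⇒x⊔y≈y (≤-by gᵖy≤gᵖx (solve 2 (λ a b → :0 :- (b :- a) := a :- b)
                         ≈-refl (gᵖ x) (gᵖ y))))))) ⟩
              majorant (x , y) - (b x y * d x y * (gᵖ x - gᵖ y) + b y x * d y x * 0#)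
                ≈⟨ +-congʳ (+-cong (*-congˡ (*-congˡ (^-congˡ (0≤x⇒∣x∣≈x (≤⇒0≤- gy≤gx)))))
                    (*-congʳ (*-congˡ (≈-sym u^-r)))) ⟩
              (u μ * (b x y * δ) + p-1 * W * (½ * (tail (x , y) + head (x , y)))) -
                  (b x y * d x y * (gᵖ x - gᵖ y) + b y x * d y x * 0#)
                ≈⟨ solve 11 (λ u B δ q W h D P Q d b′ →
                     (u :* (B :* δ) :+ q :* W :* (h :* (B :* D :* P :+ B :* D :* Q))) :-
                         (B :* d :* (P :- Q) :+ b′ :* :0)
                     := B :* (u :* δ :+ q :* (W :* D) :* (h :* (P :+ Q))) :- B :* (d :* (P :- Q))) ≈-refl
                   (u μ) (b x y) δ p-1 W ½ (d x y ^ q) (gᵖ x) (gᵖ y) (d x y) (b y x * d y x) ⟩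
              b x y * (u μ * δ + p-1 * (W * d x y ^ q) * (½ * (gᵖ x + gᵖ y))) - b x y *
                  (d x y * (gᵖ x - gᵖ y)) ∎)
              where
              δ W : ℝ
              δ = (g x - g y) ^ p
              W = u μ ^ (- r)
              gᵖy≤gᵖx : gᵖ y ≤ gᵖ x
              gᵖy≤gᵖx = ^-monoˡ 0<p (0≤g y) gy≤gx

            flow-≤ : ∀ e → flow e + flow (swap e) ≤ majorant e
            flow-≤ (x , y) with total (g y) (g x)
            ... | inj₁ gy≤gx = flow-≤-ordered gy≤gx
            ... | inj₂ gx≤gy = ≤-trans (≤-reflexive (+-comm _ _))
              (≤-trans (flow-≤-ordered gx≤gy) (≤-reflexive (majorant-sym y x)))

            -- The leading ½ reflects that `majorant` covers both orientations of an edge. By the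
            -- choice of `u` both summands are multiples of `V μ * N`, with coefficients 1 and p -
            -- 1.
            flow-bounded : PartialSums≤ flow (K μ * N)
            flow-bounded es es! = ≤-trans (partialSums-oriented 0≤flow (partialSums-mono flow-≤
                (partialSums-+ (partialSums-* (<⇒≤ 0<u) energy)
                  (partialSums-* (*-nonneg 0≤p-1 (<⇒≤ 0<V))
                    (partialSums-* 0≤½ (partialSums-+ tail-bounded head-bounded))))) es es!)
              (≤-reflexive (begin
                ½ * (u μ * (2# * (μ * N)) + p-1 * V μ * (½ * (N + N)))
                  ≈⟨ *-congˡ (+-cong (solve 4 (λ u t μ N → u :* (t :* (μ :* N))
                      := (u :* (t :* μ)) :* N) ≈-refl (u μ) 2# μ N)
                       (*-congˡ (≈-trans (distribˡ ½ N N) (½+½ N)))) ⟩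
                ½ * (u μ * (2# * μ) * N + p-1 * V μ * N)
                  ≈⟨ *-congˡ (+-congʳ (*-congʳ u-V)) ⟩
                ½ * (V μ * N + p-1 * V μ * N)
                  ≈⟨ solve 4 (λ h V N p → h :* (V :* N :+ (p :- :1) :* V :* N)
                      := h :* (p :* V) :* N) ≈-refl ½ (V μ) N p ⟩
                K μ * N ∎))

            -- If h(d) exceeds some c > K, the co-area inequality for g^p bounds every partial sum
            -- of the norm by K N / c. As `N` is the least such bound, c N ≤ K N, which contradicts
            -- N > 0.
            nodal-bound : h⁽¹⁾ G d ≤± [ K μ ]
            nodal-bound with em {h⁽¹⁾ G d ≤± [ K μ ]}
            ... | yes h≤K = h≤K
            ... | no  h≰K with ≰-gap h≰K
            ...   | c , K<c , h≰c = ⊥-elim (<⇒≱ K<c (*-cancelˡ-≤ 0<N (≤-trans (≤-reflexive (*-comm N c))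
                      (≤-trans (*-monoˡ-≤ (<⇒≤ 0<c) (norm-least norm-≤))
                        (≤-reflexive (≈-trans (quotient _ 0<c) (*-comm (K μ) N)))))))
              where
              0<c : 0# < c
              0<c = ≤-<-trans (<⇒≤ 0<K) K<c

              half-gᵖ : AtMostHalf (λ x → 0# < gᵖ x)
              half-gᵖ xs xs! 0<gᵖ = half xs xs! (All.map (λ {x} 0<gᵖx → ≰⇒> λ gx≤0 →
                <⇒≱ 0<gᵖx (≤-reflexive (≈-trans (^-congˡ (antisym gx≤0 (0≤g x))) (0^ 0<p)))) 0<gᵖ)

              norm-≤ : PartialSums≤ (λ x → g x ^ p * m x) ((K μ * N) * c ⁻¹)
              norm-≤ F F! = *-cancelˡ-≤ 0<c (≤-trans
                  (*-monoˡ-≤ (<⇒≤ 0<c) (≤-reflexive (sum-cong (λ x → *-comm (gᵖ x) (m x)) F)))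
                (≤-trans (coarea (λ (x , y) → b x y * d x y) (λ (x , y) → *-nonneg (b-nonneg x y) (0≤d x y))
                    gᵖ 0≤gᵖ m (0≤m) c (<⇒≤ 0<c)
                    (isoperimetric-cut (<⇒≤ 0<c) h≰c gᵖ half-gᵖ)
                    F F! (K μ * N) flow-bounded)
                  (≤-reflexive (≈-sym (quotient _ 0<c)))))

      -- Testing the weak solution and its sign changes

      D-mono : ∀ {f g} → (∀ x → ∣ g x ∣ ≤ ∣ f x ∣) → (∀ x y → ∣ g x - g y ∣ ≤ ∣ f x - f y ∣) → D G p f →
          D G p g
      D-mono {f} {g} size slope (f∈ℓᵖ , ℰf<∞) =
          ^-<∞ (p ⁻¹) (<∞-mono (∑-mono (λ x → *-monoʳ-≤ (<⇒≤ (m-pos x)) (^-monoˡ 0<p (0≤∣x∣ (g x)) (size x))))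
            (^-<∞⁻ (p ⁻¹) f∈ℓᵖ))
        , ·-<∞ (2# ⁻¹) (<∞-mono (∑-mono
            (λ (x , y) → *-monoˡ-≤ (b-nonneg x y) (^-monoˡ 0<p (0≤∣x∣ (g x - g y)) (slope x y))))
            (·-<∞⁻ (2# ⁻¹) ℰf<∞))

      -- Finite total mass makes constants admissible test functions; they force `f` to change sign.
      D-const : ∀ k → D G p (λ _ → k)
      D-const k =
          ^-<∞ (p ⁻¹) (_ , ∑-bounded (partialSums-* (0≤∣∣^ k) (mass-bounded)))
        , ·-<∞ (2# ⁻¹) (0# , ∑-bounded λ es _ → sum-nonpos (λ (x , y) →
            ≤-reflexive (≈-trans (*-congˡ (∣∣^-0 (-‿inverseʳ k))) (zeroʳ (b x y)))) es)

      module _ {μ : ℝ} {f : X → ℝ} (non-constant : NonConstant f) (weak : WeakSolution G p μ f) where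

        f∈D : D G p f
        f∈D = proj₁ weak

        nonzero : ∃[ x ] ¬ (f x ≈ 0#)
        nonzero with em {∃[ x ] ¬ (f x ≈ 0#)}
        ... | yes q = q
        ... | no ∄x = let (x , y , fx≉fy) = non-constant in
                ⊥-elim (fx≉fy (≈-trans (zero-at x) (≈-sym (zero-at y))))
          where
          zero-at : ∀ x → f x ≈ 0#
          zero-at x with em {f x ≈ 0#}
          ... | yes e  = e
          ... | no ¬e = ⊥-elim (∄x (x , ¬e))

        -- Partial-sum form of ‖g‖ᵖ = N together with ℰ(g) ≤ μ N; the factor `2#` undoes the ½ in ℰ.
        EnergyIdentity : (X → ℝ) → ℝ → Set
        EnergyIdentity g N = PartialSums≤ (λ x → ∣ g x ∣ ^ p * m x) N
          × (∀ {t} → PartialSums≤ (λ x → ∣ g x ∣ ^ p * m x) t → N ≤ t)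
          × PartialSums≤ {I = X × X} (λ (x , y) → b x y * ∣ g x - g y ∣ ^ p) (2# * (μ * N))

        Tested : (X → ℝ) → ℝ → ℝ → Set
        Tested g s t = HasSum {X × X} (λ (x , y) → b x y * φ G p (f x - f y) * (g x - g y)) s
          × HasSum (λ x → φ G p (f x) * g x * m x) t
          × 2# ⁻¹ * s ≈ μ * t

        -- The mass terms of the weak equation equal |ν f|^p m by `φ-mass`, and its edge terms
        -- dominate the energy terms by `φ-energy`. Both families are nonnegative, so their sums
        -- bound all partial sums.
        tested-identity : ∀ {ν} → Contraction ν → ∀ {s t} → Tested (ν ∘ f) s t → EnergyIdentity (ν ∘ f) t
        tested-identity {ν} contraction {s} {t} (hasSum-s , hasSum-t , eq) =
              partialSums-mono (λ x → ≤-reflexive (≈-sym (mass-term x)))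
                  (hasSum⇒partialSums≤ 0≤mass-term hasSum-t)
            , (λ bounded → hasSum-least 0≤mass-term hasSum-t
                 (partialSums-mono (λ x → ≤-reflexive (mass-term x)) bounded))
            , λ es es! → ≤-trans (partialSums-mono energy-term (hasSum⇒partialSums≤ 0≤energy-term hasSum-s)
                es es!)
                (≤-reflexive (begin
                  s                    ≈⟨ quotient s 0<2 ⟨
                  2# * (s * 2# ⁻¹)     ≈⟨ *-congˡ (≈-trans (*-comm s (2# ⁻¹)) eq) ⟩
                  2# * (μ * t)         ∎))
          where
          mass-term : ∀ x → φ G p (f x) * ν (f x) * m x ≈ ∣ ν (f x) ∣ ^ p * m x
          mass-term x = *-congʳ (φ-mass contraction (f x))

          0≤mass-term : Nonneg (λ x → φ G p (f x) * ν (f x) * m x)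
          0≤mass-term x = ≤-trans (*-nonneg (0≤∣∣^ (ν (f x))) (<⇒≤ (m-pos x)))
              (≤-reflexive (≈-sym (mass-term x)))

          energy-term : ∀ ((x , y) : X × X) →
            b x y * ∣ ν (f x) - ν (f y) ∣ ^ p ≤ b x y * φ G p (f x - f y) * (ν (f x) - ν (f y))
          energy-term (x , y) = ≤-trans (*-monoˡ-≤ (b-nonneg x y) (φ-energy contraction (f x) (f y)))
            (≤-reflexive (≈-sym (*-assoc (b x y) _ _)))

          0≤energy-term : Nonneg {I = X × X} (λ (x , y) → b x y * φ G p (f x - f y) * (ν (f x) - ν (f y)))
          0≤energy-term (x , y) = ≤-trans (*-nonneg (b-nonneg x y) (0≤∣∣^ (ν (f x) - ν (f y))))
              (energy-term (x , y))

        test-with : ∀ {ν} → Contraction ν → ∃[ N ] EnergyIdentity (ν ∘ f) N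
        test-with {ν} contraction =
          let (s , t , tested) = proj₂ weak (ν ∘ f) (D-mono
                (λ x → Contraction.∣ν∣≤ contraction (f x))
                    (λ x y → Contraction.∣ν-ν∣≤ contraction (f x) (f y)) f∈D)
          in t , tested-identity contraction {s} {t} tested

        norm-pos : ∀ {g N} → EnergyIdentity g N → ∀ {x} → ¬ (g x ≈ 0#) → 0# < N
        norm-pos (norm , _ , _) {x} gx≉0 = <-≤-trans (*-pos (0<∣∣^ gx≉0) (m-pos x)) (partialSums-term norm x)

        -- Testing with `f` itself: the empty partial sum of the energy reads 0 ≤ 2 μ N, and N > 0.
        0≤μ : 0# ≤ μ
        0≤μ = let (N , identity) = test-with id-contraction in
          nonneg N (norm-pos {f} identity (proj₂ nonzero)) (proj₂ (proj₂ identity) [] [])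
          where
          nonneg : ∀ N → 0# < N → 0# ≤ 2# * (μ * N) → 0# ≤ μ
          nonneg N 0<N h = *-cancelˡ-≤ 0<N (*-cancelˡ-≤ 0<2 (≤-trans
            (≤-reflexive (≈-trans (*-congˡ (zeroʳ N)) (zeroʳ 2#)))
            (≤-trans h (≤-reflexive (*-congˡ (*-comm μ N))))))

        -- A zero eigenvalue makes f constant across every edge, so a superlevel
        -- set of f or its complement has no boundary.
        zero-eigenvalue : μ ≈ 0# → ∀ d → Rₚ G p d → h⁽¹⁾ G d ≤± [ 0# ]
        zero-eigenvalue μ≈0 d (0≤d , _) = separate (proj₂ (proj₂ non-constant))
          where
          N : ℝ
          N = proj₁ (test-with id-contraction)

          energy : PartialSums≤ {I = X × X} (λ (x , y) → b x y * ∣ f x - f y ∣ ^ p) (2# * (μ * N))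
          energy = proj₂ (proj₂ (proj₂ (test-with id-contraction)))

          edge-≤0 : ∀ x y → ¬ (f x ≈ f y) → b x y ≤ 0#
          edge-≤0 x y fx≉fy = *-cancelˡ-≤ (0<∣∣^ {f x - f y} λ e → fx≉fy (begin
                f x              ≈⟨ solve 2 (λ a b → a := (a :- b) :+ b) ≈-refl (f x) (f y) ⟩
                (f x - f y) + f y ≈⟨ +-congʳ e ⟩
                0# + f y         ≈⟨ +-identityˡ (f y) ⟩
                f y              ∎))
            (≤-trans (≤-reflexive (*-comm _ (b x y))) (≤-trans (partialSums-term energy (x , y))
              (≤-reflexive (≈-trans (*-congˡ (≈-trans (*-congʳ μ≈0) (zeroˡ N)))
                  (≈-trans (zeroʳ 2#) (≈-sym (zeroʳ _)))))))

          ordered : ∀ {x y} → f x < f y → h⁽¹⁾ G d ≤± [ 0# ]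
          -- With threshold `f x`, the superlevel set contains `y` and its complement contains `x`,
          -- so whichever has at most half the mass is nonempty.
          ordered {x} {y} fx<fy with atMostHalf-disjoint {λ z → f x < f z} {λ z → f z ≤ f x} <⇒≱
          ... | inj₁ half = zero-cut fx<fy half
                  (λ {z} {w} p ¬q → edge-≤0 z w λ e → ¬q (<-respʳ e p)) d 0≤d
          ... | inj₂ half = zero-cut ≤-refl half
                  (λ {z} {w} p ¬q → edge-≤0 z w λ e → ¬q (≤-trans (≤-reflexive (≈-sym e)) p)) d 0≤d

          separate : ∀ {x y} → ¬ (f x ≈ f y) → h⁽¹⁾ G d ≤± [ 0# ]
          separate {x} {y} fx≉fy with total (f x) (f y)
          ... | inj₁ fx≤fy = ordered (fx≤fy , fx≉fy)
          ... | inj₂ fy≤fx = ordered (fy≤fx , fx≉fy ∘ ≈-sym)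

        module _ (0<μ : 0# < μ) where

          -- A constant test function makes the energy side zero. As μ > 0, the mass side is zero
          -- too, and its terms are nonnegative, so each vanishes.
          one-signed : ∀ k → (∀ x → 0# ≤ φ G p (f x) * k) → ∀ x → φ G p (f x) * k ≤ 0#
          one-signed k 0≤φk x = let (s , t , tested) = proj₂ weak (λ _ → k) (D-const k) in bound {s} {t} tested
            where
            flat : ∀ ((x , y) : X × X) → b x y * φ G p (f x - f y) * (k - k) ≈ 0#
            flat (x , y) = ≈-trans (*-congˡ (-‿inverseʳ k)) (zeroʳ _)

            bound : ∀ {s t} → Tested (λ _ → k) s t → φ G p (f x) * k ≤ 0#
            bound {s} {t} (hasSum-s , hasSum-t , eq) = *-cancelˡ-≤ (m-pos x)
                (≤-trans (≤-reflexive (*-comm (m x) _))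
                (≤-trans (partialSums-term (hasSum⇒partialSums≤ (λ x → *-nonneg (0≤φk x) (<⇒≤ (m-pos x)))
                    hasSum-t) x)
                  (≤-trans t≤0 (≤-reflexive (≈-sym (zeroʳ (m x)))))))
              where
              s≤0 : s ≤ 0#
              s≤0 = hasSum-least (λ e → ≤-reflexive (≈-sym (flat e))) hasSum-s
                λ es _ → sum-nonpos (λ e → ≤-reflexive (flat e)) es
              t≤0 : t ≤ 0#
              t≤0 = *-cancelˡ-≤ 0<μ (≤-trans (≤-reflexive (≈-sym eq)) (≤-trans (*-monoˡ-≤ 0≤½ s≤0)
                (≤-reflexive (≈-trans (zeroʳ ½) (≈-sym (zeroʳ μ))))))

          φ-scaled : ∀ t k → φ G p t * k ≈ ∣ t ∣ ^ (p - 2#) * (t * k)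
          φ-scaled t k = *-assoc _ t k

          -- The condition on `k` means k = ±1, so one argument serves both signs. If f k were
          -- nowhere positive, φ(f) (-k) would be nonnegative, hence zero, and `f` would vanish
          -- identically.
          takes-sign : ∀ k → k * k ≈ 1# → ∃[ x ] (0# < f x * k)
          takes-sign k k²≈1 with em {∃[ x ] (0# < f x * k)}
          ... | yes q = q
          ... | no ∄x = ⊥-elim (proj₂ nonzero (vanishes (proj₁ nonzero)))
            where
            0≤-fk : ∀ x → 0# ≤ f x * (- k)
            0≤-fk x = ≤-by (≮⇒≥ λ q → ∄x (x , q)) (solve 2 (λ f k → f :* (:- k) :- :0
                := :0 :- f :* k) ≈-refl (f x) k)

            0≤φ : ∀ x → 0# ≤ φ G p (f x) * (- k)
            0≤φ x with em {f x ≈ 0#}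
            ... | yes e = ≤-reflexive (≈-sym
                (≈-trans (*-congʳ (≈-trans (*-congˡ e) (zeroʳ _))) (zeroˡ (- k))))
            ... | no ¬e = ≤-trans (*-nonneg (<⇒≤ (^-pos (p - 2#) (0<∣∣ ¬e))) (0≤-fk x))
                            (≤-reflexive (≈-sym (φ-scaled (f x) (- k))))

            vanishes : ∀ x → f x ≈ 0#
            vanishes x with em {f x ≈ 0#}
            ... | yes e = e
            ... | no ¬e = begin
                f x                  ≈⟨ *-identityʳ (f x) ⟨
                f x * 1#             ≈⟨ *-congˡ k²≈1 ⟨
                f x * (k * k)        ≈⟨ solve 2 (λ f k → f :* (k :* k) := (:- k) :* (f :* (:- k)))
                    ≈-refl (f x) k ⟩
                - k * (f x * (- k))  ≈⟨ *-congˡ (antisym -fk≤0 (0≤-fk x)) ⟩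
                - k * 0#             ≈⟨ zeroʳ (- k) ⟩
                0#                   ∎
              where
              0<c : 0# < ∣ f x ∣ ^ (p - 2#)
              0<c = ^-pos (p - 2#) (0<∣∣ ¬e)
              -fk≤0 : f x * (- k) ≤ 0#
              -fk≤0 = *-cancelˡ-≤ 0<c (≤-trans (≤-reflexive (≈-sym (φ-scaled (f x) (- k))))
                (≤-trans (one-signed (- k) 0≤φ x) (≤-reflexive (≈-sym (zeroʳ _)))))

          -- The bound is applied to |ν f|, which is nonnegative, has the same norm and, by the
          -- reverse triangle inequality, no larger energy.
          nodal-domain : ∀ {ν} → Contraction ν → ∀ {x} → ¬ (ν (f x) ≈ 0#) →
            AtMostHalf (λ x → ¬ (ν (f x) ≈ 0#)) → ∀ d → Rₚ G p d → h⁽¹⁾ G d ≤± [ K μ ]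
          nodal-domain {ν} contraction {x} νfx≉0 half d (0≤d , d-sym , d-row) =
            let (N , identity) = test-with contraction in bound N identity
            where
            bound : ∀ N → EnergyIdentity (ν ∘ f) N → h⁽¹⁾ G d ≤± [ K μ ]
            bound N identity@(norm , norm-least , energy) =
              NodalBound.nodal-bound 0<μ (λ x → ∣ ν (f x) ∣) (λ x → 0≤∣x∣ (ν (f x)))
                (λ xs xs! 0<g → half xs xs! (All.map (λ 0<∣t∣ t≈0 →
                   proj₂ 0<∣t∣ (≈-sym (≈-trans (∣∣-cong t≈0) (0≤x⇒∣x∣≈x ≤-refl)))) 0<g))
                (norm-pos {ν ∘ f} {N} identity {x} νfx≉0) norm norm-least
                (partialSums-mono (λ (x , y) → *-monoˡ-≤ (b-nonneg x y)
                  (^-monoˡ 0<p (0≤∣x∣ _) (∣∣x∣-∣y∣∣≤∣x-y∣ (ν (f x)) (ν (f y))))) energy)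
                0≤d d-sym d-row

          positive-eigenvalue : ∀ d → Rₚ G p d → h⁽¹⁾ G d ≤± [ K μ ]
          positive-eigenvalue with atMostHalf-disjoint {λ x → 0# < f x} {λ x → f x < 0#}
              (λ 0<fx fx<0 → <⇒≱ 0<fx (<⇒≤ fx<0))
          ... | inj₁ half = nodal-domain ⊔0-contraction {x}
              (λ e → >⇒≉0 0<fx (≈-trans (≈-sym (x≤y⇒y⊔x≈y (<⇒≤ 0<fx))) e))
                  (λ xs xs! ν≉0 → half xs xs! (All.map (λ t≉0 → ≰⇒> λ t≤0 → t≉0 (x≤y⇒x⊔y≈y t≤0)) ν≉0))
            where
            x : X
            x = proj₁ (takes-sign 1# (*-identityʳ 1#))
            0<fx : 0# < f x
            0<fx = <-respʳ (*-identityʳ (f x)) (proj₂ (takes-sign 1# (*-identityʳ 1#)))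
          ... | inj₂ half = nodal-domain ⊓0-contraction {x}
              (λ e → proj₂ fx<0 (≈-trans (≈-sym (x≤y⇒x⊓y≈x (<⇒≤ fx<0))) e))
                  (λ xs xs! ν≉0 → half xs xs! (All.map (λ t≉0 → ≰⇒> λ 0≤t → t≉0 (x≤y⇒y⊓x≈x 0≤t)) ν≉0))
            where
            sign : ∃[ x ] (0# < f x * - 1#)
            sign = takes-sign (- 1#) (solve 0 ((:- :1) :* (:- :1) := :1) ≈-refl)
            x : X
            x = proj₁ sign
            fx<0 : f x < 0#
            fx<0 = <-by (proj₂ sign) (solve 1 (λ t → :0 :- t := t :* (:- :1) :- :0) ≈-refl (f x))

        -- Passing to the supremum over the metrics d

        -- A common form for the cases μ = 0 and μ > 0; `k` does not depend on `d`, so it also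
        -- bounds the supremum.
        IsCheegerBound : ℝ → Set
        IsCheegerBound k = 0# ≤ k × (2# ^ p-1 * (p ^ p) ⁻¹) * k ^ p ≤ μ × (∀ d → Rₚ G p d → h⁽¹⁾ G d ≤± [ k ])

        cheeger-bound : ∃[ k ] IsCheegerBound k
        cheeger-bound = by-cases (0≤⇒≈0⊎> 0≤μ)
          where
          by-cases : μ ≈ 0# ⊎ 0# < μ → ∃[ k ] IsCheegerBound k
          by-cases (inj₁ μ≈0) = 0# , ≤-refl
            , ≤-reflexive (≈-trans (≈-trans (*-congˡ (0^ 0<p)) (zeroʳ _)) (≈-sym μ≈0))
            , zero-eigenvalue μ≈0
          by-cases (inj₂ 0<μ) = K μ , <⇒≤ (0<K 0<μ)
            , ≤-reflexive (constant 0<μ) , positive-eigenvalue 0<μ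

        cheeger : ∀ {l} → [ μ ] ≤± l → (2# ^ p-1 * (p ^ p) ⁻¹) · (h⁽¹⁾ₚ G p ^± p) ≤± l
        cheeger {l} μ≤l = let (k , 0≤k , ck≤μ , h≤k) = cheeger-bound in compare k ck≤μ (h≤[k] k h≤k) 0≤h
          where
          -- A member of `Rₚ` makes the supremum nonnegative, as the monotonicity of the p-th power
          -- requires.
          zero-metric : Rₚ G p (λ _ _ → 0#)
          zero-metric = (λ _ _ → ≤-refl) , (λ _ _ → ≈-refl) , λ x → ∑-bounded λ ys _ →
            ≤-trans (sum-nonpos (λ y → ≤-reflexive (≈-trans (*-congˡ (0^ 0<q)) (zeroʳ (b x y)))) ys)
                (<⇒≤ (m-pos x))

          h≤[k] : ∀ k → (∀ d → Rₚ G p d → h⁽¹⁾ G d ≤± [ k ]) → h⁽¹⁾ₚ G p ≤± [ k ]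
          h≤[k] k h≤k = IsSup.least (proj₂ (sup-exists (Rₚ G p) (h⁽¹⁾ G))) λ {d} → h≤k d

          0≤h : [ 0# ] ≤± h⁽¹⁾ₚ G p
          0≤h = ≤±-trans (0≤h⁽¹⁾ (λ _ _ → 0#) (λ _ _ → ≤-refl))
            (IsSup.bound (proj₂ (sup-exists (Rₚ G p) (h⁽¹⁾ G))) zero-metric)

          compare : ∀ {h} k → (2# ^ p-1 * (p ^ p) ⁻¹) * k ^ p ≤ μ → h ≤± [ k ] → [ 0# ] ≤± h →
              (2# ^ p-1 * (p ^ p) ⁻¹) · (h ^± p) ≤± l
          compare {⊥±}    _ _    _   _ = E.⊥±≤ _
          compare {[ x ]} k ck≤μ h≤k 0≤h = ≤±-trans E.[ ≤-trans (*-monoˡ-≤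
              (*-nonneg (<⇒≤ (^-pos p-1 0<2)) (<⇒≤ (⁻¹-pos (^-pos p 0<p))))
              (^-monoˡ 0<p (E.[≤]-injective 0≤h) (E.[≤]-injective h≤k))) ck≤μ ] μ≤l

theorem3p2 : (em : ExcludedMiddle 0ℓ) (R : CompleteOrderedField) (Pow : RealPower R) →
    let open Analysis em R Pow in
    (X : Set) → X → X ↣ ℕ → (G : Graph X) → mass G U <∞ →
    (p : ℝ) → 1# < p →
    (μ : ℝ) → λ⁽¹⁾ G p ≈± [ μ ] →
    (f : X → ℝ) → NonConstant f → WeakSolution G p μ f →
    (2# ^ (p - 1#) * (p ^ p) ⁻¹) · (h⁽¹⁾ₚ G p ^± p) ≤± λ⁽¹⁾ G p
theorem3p2 em R Pow X _ _ G m<∞ p 1<p μ λ≈μ f non-constant weak =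
  let (M , mass≡M) = ∑-finite m<∞
  in cheeger G M mass≡M p 1<p non-constant weak (≤±-reflexive (≈±-sym λ≈μ))
  where
  open ExtendedReals em R Pow
  open CheegerInequality.WeightedGraph em R Pow
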